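{- For every $m\in\mathbb Z$, \[ \mathcal A=\bigcap_{k\in\mathbb Z}\mathcal T_k=\mathcal T_{m-1}\cap\mathcal T_m\cap\mathcal T_{m+1},\qquad\text{where }\mathcal T_k=\mathbb Z[\mathbb P][x_k^{\pm1},x_{k+1}^{\pm1}]. \]
   Context: Fix positive integers $\ell_1,\ell_2$ and independent variables $p_{i,k}$ ($i=1,2$, $1\le k\le\ell_i$), $p_{i,0}=1$. Let $\mathbb P$ be the group of Laurent monomials in the $p_{i,k}$ and $\mathbb Z[\mathbb P]$ its group ring; $\mathcal F=\mathbb Q(p_{i,k})(x_1,x_2)$ with $x_1,x_2$ independent. Put $P_1(z)=1+\sum_{k=1}^{\ell_1}p_{1,k}z^k$, $P_2(z)=1+\sum_{k=1}^{\ell_2}p_{2,k}z^k$, $\overline P_i(z)=z^{\ell_i}P_i(z^{ -1})/p_{i,\ell_i}$. Define $x_k\in\mathcal F$ for all $k\in\mathbb Z$ from $x_1,x_2$ by $x_{k+1}x_{k-1}=P_1(x_k)$ if $k\equiv1$, $P_2(x_k)$ if $k\equiv2$, $\overline P_1(x_k)$ if $k\equiv3$, $\overline P_2(x_k)$ if $k\equiv0\pmod4$. Let $\mathcal A$ be the $\mathbb Z[\mathbb P]$-subalgebra of $\mathcal F$ generated by all $x_k$. -}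

module Defs where

open import Algebra.Apartness.Bundles using (HeytingCommutativeRing; HeytingField)
open import Algebra.Bundles using (CommutativeRing)
open import Algebra.Morphism.Structures using (IsRingHomomorphism)
open import Data.Fin.Base using (Fin; zero; suc; toℕ; fromℕ; _↑ˡ_; _↑ʳ_)
open import Data.Integer.Base as ℤ using (ℤ; +_; 1ℤ; _%ℕ_)
open import Data.List.Base using (List; []; _∷_)
open import Data.List.Relation.Unary.Any using (Any; here; there)
open import Data.Nat.Base as ℕ using (ℕ; zero; suc)
open import Data.Product.Base using (∃-syntax; ∃₂; _×_; _,_; proj₁)
open import Data.Rational.Base as ℚ using (ℚ; 0ℚ; 1ℚ)
open import Data.Sum.Base using (_⊎_)
open import Data.Vec.Functional as Vector using (Vector)
open import Data.Vec.Functional.Properties using (lookup-++ˡ; lookup-++ʳ)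
open import Function.Base using (_∘_)
open import Level using (Level; _⊔_)
open import Relation.Binary.PropositionalEquality as ≡ using (_≡_; _≢_)
open import Relation.Unary using (Pred; _∪_)

-- Polynomials over ℚ in n variables, as iterated univariate polynomials given
-- by lists of coefficients, constant term first; trailing zeros are allowed.
-- Variable zero is the outermost one.

Poly : ℕ → Set
Poly zero    = ℚ
Poly (suc n) = List (Poly n)

NonZeroPoly : ∀ n → Poly n → Set
NonZeroPoly zero    c = c ≢ 0ℚ
NonZeroPoly (suc n) f = Any (NonZeroPoly n) f

0P 1P : ∀ n → Poly n
0P zero    = 0ℚ
0P (suc n) = []
1P zero    = 1ℚ
1P (suc n) = 1P n ∷ []

X : ∀ {n} → Fin n → Poly n
X {suc n} zero    = 0P n ∷ 1P n ∷ []
X {suc n} (suc i) = X i ∷ []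

1P-nonZero : ∀ n → NonZeroPoly n (1P n)
1P-nonZero zero    = λ ()
1P-nonZero (suc n) = here (1P-nonZero n)

X-nonZero : ∀ {n} (i : Fin n) → NonZeroPoly n (X i)
X-nonZero {suc n} zero    = there (here (1P-nonZero n))
X-nonZero {suc n} (suc i) = here (X-nonZero i)

module _ {c a ℓ : Level} (F : HeytingField c a ℓ) where

  open HeytingField F hiding (zero)
  open CommutativeRing
    (HeytingCommutativeRing.commutativeRing heytingCommutativeRing)
    using (rawRing; semiring)
  open import Algebra.Apartness.Properties.HeytingCommutativeRing
    heytingCommutativeRing using (#-congʳ; 1#0)
  open import Algebra.Properties.Semiring.Exp semiring using (_^_)
  open import Algebra.Properties.Semiring.Sum semiring using (sum)

  module _ (ι : ℚ → Carrier) where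

    eval : ∀ n → Vector Carrier n → Poly n → Carrier
    eval zero    v c        = ι c
    eval (suc n) v []       = 0#
    eval (suc n) v (f ∷ fs) =
      eval n (v ∘ suc) f + v zero * eval (suc n) v fs

  -- F is ℚ(v₀, …, vₙ₋₁) with v₀, …, vₙ₋₁ independent: the evaluation of
  -- polynomials at v is injective, and every element of F is a quotient of
  -- values.

  record IsRationalFunctionField {n} (v : Vector Carrier n) :
         Set (c ⊔ a ⊔ ℓ) where
    field
      ι                 : ℚ → Carrier
      ι-isHomomorphism  : IsRingHomomorphism ℚ.+-*-rawRing rawRing ι
      independent       : ∀ f → NonZeroPoly n f → eval ι n v f # 0#
      fractions         : ∀ y → ∃₂ λ f g → NonZeroPoly n g ×
                          y * eval ι n v g ≈ eval ι n v f

    open IsRingHomomorphism ι-isHomomorphism using (0#-homo; 1#-homo)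

    private
      eval-0P : ∀ m (w : Vector Carrier m) → eval ι m w (0P m) ≈ 0#
      eval-0P zero    w = 0#-homo
      eval-0P (suc m) w = refl

      eval-constant : ∀ m (w : Vector Carrier (suc m)) f →
                      eval ι (suc m) w (f ∷ []) ≈ eval ι m (w ∘ suc) f
      eval-constant m w f = trans (+-congˡ (zeroʳ _)) (+-identityʳ _)

      eval-1P : ∀ m (w : Vector Carrier m) → eval ι m w (1P m) ≈ 1#
      eval-1P zero    w = 1#-homo
      eval-1P (suc m) w =
        trans (eval-constant m w (1P m)) (eval-1P m (w ∘ suc))

    eval-X : ∀ {m} (w : Vector Carrier m) i → eval ι m w (X i) ≈ w i
    eval-X {suc m} w zero = trans
      (+-cong (eval-0P m (w ∘ suc)) (*-congˡ (eval-1P (suc m) w)))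
      (trans (+-identityˡ _) (*-identityʳ _))
    eval-X {suc m} w (suc i) =
      trans (eval-constant m w (X i)) (eval-X (w ∘ suc) i)

    variable#0 : ∀ i → v i # 0#
    variable#0 i = #-congʳ (eval-X v i) (independent (X i) (X-nonZero i))

  -- Strictly the inverse of y - 0#, which is what #⇒invertible provides.

  inverse : ∀ {y} → y # 0# → Carrier
  inverse y#0 = proj₁ (#⇒invertible y#0)

  -- The coefficients 1, p₁, …, pₗ of P(z) = 1 + Σₖ pₖ zᵏ.

  coeff : ∀ {l} → Vector Carrier l → Vector Carrier (suc l)
  coeff p = 1# Vector.∷ p

  P : ∀ {l} → Vector Carrier l → Carrier → Carrier
  P p z = sum λ k → coeff p k * z ^ toℕ k

  leading : ∀ {l} → Vector Carrier l → Carrier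
  leading {l} p = coeff p (fromℕ l)

  -- P̄(z) = zˡ P(z⁻¹) / pₗ, expanded as a polynomial in z.

  P̄ : ∀ {l} (p : Vector Carrier l) → leading p # 0# → Carrier → Carrier
  P̄ {l} p pₗ#0 z =
    (sum λ k → coeff p k * z ^ (l ℕ.∸ toℕ k)) * inverse pₗ#0

  leading#0 : ∀ {l} (p : Vector Carrier l) → (∀ k → p k # 0#) → leading p # 0#
  leading#0 {zero}  p p#0 = 1#0
  leading#0 {suc l} p p#0 = p#0 (fromℕ l)

  data Subring⟨_⟩ {s} (S : Pred Carrier s) : Pred Carrier (c ⊔ a ⊔ s) where
    gen  : ∀ {y} → S y → Subring⟨ S ⟩ y
    zero : Subring⟨ S ⟩ 0#
    one  : Subring⟨ S ⟩ 1#
    neg  : ∀ {y} → Subring⟨ S ⟩ y → Subring⟨ S ⟩ (- y)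
    add  : ∀ {y z} → Subring⟨ S ⟩ y → Subring⟨ S ⟩ z → Subring⟨ S ⟩ (y + z)
    mul  : ∀ {y z} → Subring⟨ S ⟩ y → Subring⟨ S ⟩ z → Subring⟨ S ⟩ (y * z)
    resp : ∀ {y z} → y ≈ z → Subring⟨ S ⟩ y → Subring⟨ S ⟩ z

  _±¹ : Carrier → Pred Carrier a
  (y ±¹) z = z ≈ y ⊎ y * z ≈ 1#

  module _ {l₁ l₂ : ℕ} (p₁ : Vector Carrier l₁) (p₂ : Vector Carrier l₂)
           (x : ℤ → Carrier) where

    IsAmbientField : Set (c ⊔ a ⊔ ℓ)
    IsAmbientField = IsRationalFunctionField
      (x 1ℤ Vector.∷ x (+ 2) Vector.∷ (p₁ Vector.++ p₂))

    module _ (ambient : IsAmbientField) where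

      open IsRationalFunctionField ambient using (variable#0)

      p₁#0 : ∀ k → p₁ k # 0#
      p₁#0 k = ≡.subst (_# 0#) (lookup-++ˡ p₁ p₂ k)
                 (variable#0 (suc (suc (k ↑ˡ l₂))))

      p₂#0 : ∀ k → p₂ k # 0#
      p₂#0 k = ≡.subst (_# 0#) (lookup-++ʳ p₁ p₂ k)
                 (variable#0 (suc (suc (l₁ ↑ʳ k))))

      P̄₁ P̄₂ : Carrier → Carrier
      P̄₁ = P̄ p₁ (leading#0 p₁ p₁#0)
      P̄₂ = P̄ p₂ (leading#0 p₂ p₂#0)

    -- x₁ and x₂ are independent variables of F; the exchange relations then
    -- determine all other xₖ, since every xₖ is nonzero.

    record IsClusterSequence : Set (c ⊔ a ⊔ ℓ) where
      field
        ambient   : IsAmbientField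
        exchange₁ : ∀ k → k %ℕ 4 ≡ 1 →
                    x (k ℤ.+ 1ℤ) * x (k ℤ.- 1ℤ) ≈ P p₁ (x k)
        exchange₂ : ∀ k → k %ℕ 4 ≡ 2 →
                    x (k ℤ.+ 1ℤ) * x (k ℤ.- 1ℤ) ≈ P p₂ (x k)
        exchange₃ : ∀ k → k %ℕ 4 ≡ 3 →
                    x (k ℤ.+ 1ℤ) * x (k ℤ.- 1ℤ) ≈ P̄₁ ambient (x k)
        exchange₀ : ∀ k → k %ℕ 4 ≡ 0 →
                    x (k ℤ.+ 1ℤ) * x (k ℤ.- 1ℤ) ≈ P̄₂ ambient (x k)

    -- The group of Laurent monomials, as the subgroup of the units of F
    -- generated by the variables.

    data ℙ : Pred Carrier (c ⊔ a) where
      var₁ : ∀ k → ℙ (p₁ k)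
      var₂ : ∀ k → ℙ (p₂ k)
      one  : ℙ 1#
      mul  : ∀ {y z} → ℙ y → ℙ z → ℙ (y * z)
      inv  : ∀ {y z} → y * z ≈ 1# → ℙ y → ℙ z
      resp : ∀ {y z} → y ≈ z → ℙ y → ℙ z

    -- The group ring embeds in F because distinct Laurent monomials are
    -- linearly independent over ℤ; ℤ[ℙ] is its image.

    ℤ[ℙ] : Pred Carrier (c ⊔ a)
    ℤ[ℙ] = Subring⟨ ℙ ⟩

    ℤ[ℙ][_] : ∀ {s} → Pred Carrier s → Pred Carrier (c ⊔ a ⊔ s)
    ℤ[ℙ][ S ] = Subring⟨ ℤ[ℙ] ∪ S ⟩

    𝒜 : Pred Carrier (c ⊔ a)
    𝒜 = ℤ[ℙ][ (λ y → ∃[ k ] y ≈ x k) ]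

    𝒯 : ℤ → Pred Carrier (c ⊔ a)
    𝒯 k = ℤ[ℙ][ (x k ±¹) ∪ (x (k ℤ.+ 1ℤ) ±¹) ]

{-# OPTIONS --safe #-}

-- Let R = ℤ[ℙ], and let x₀, x₁, x₂, x₃ be consecutive, with x₀x₂ = p(x₁) and
-- x₁x₃ = q(x₂), where p(0) = q(0) = 1.  Comparing coefficients of powers of
-- x₂ gives R[x₁±¹, x₂±¹] ∩ R[x₁±¹, x₀±¹] = R[x₁±¹][x₀, x₂].  Writing
-- q(z) = 1 + z s(z), the identity x₁⁻¹ = x₃ - x₁⁻¹ x₂ s(x₂) shows that this
-- ring is A + R[x₁±¹, x₂], where A = R[x₀, x₁, x₂, x₃]; and comparing
-- coefficients of powers of x₁ gives R[x₁±¹, x₂] ∩ R[x₂±¹, x₃±¹] ⊆ A.  Hence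
-- three consecutive tori meet in A.  Moreover x₄ ∈ A: modulo x₂ the variable
-- x₃ is inverse to x₁, so the reciprocal polynomial of p takes at x₃ a unit
-- multiple of the value p(x₁) = x₀x₂, and is therefore divisible by x₂ in A.
-- So A is the same for all windows; it is 𝒜, and lies in every torus.

module Submission where

open import Defs
open import Algebra.Apartness.Bundles
  using (HeytingField; HeytingCommutativeRing)
open import Algebra.Bundles using (CommutativeRing)
open import Algebra.Morphism.Structures using (IsRingHomomorphism)
open import Data.Empty using (⊥-elim)
open import Data.Fin.Base using (zero; suc; toℕ; fromℕ; _↑ˡ_; _↑ʳ_)
open import Data.Integer.Base as ℤ using (ℤ; +_; -[1+_]; 0ℤ; 1ℤ; _%ℕ_)
open import Data.Integer.DivMod using (n%ℕd<d)
import Data.Integer.Properties as ℤ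
open import Data.List.Base using ([]; _∷_)
open import Data.List.Relation.Unary.Any as Any using (here; there)
open import Data.Maybe.Base using (Maybe; just; nothing)
open import Data.Nat.Base as ℕ using (ℕ; zero; suc; s≤s; NonZero)
open import Data.Nat.DivMod using (%-distribˡ-+)
import Data.Nat.Properties as ℕ
open import Data.Product.Base using (∃-syntax; ∃₂; _×_; _,_; proj₁; proj₂)
open import Data.Rational.Base as ℚ using (0ℚ)
import Data.Rational.Properties as ℚ
open import Data.Sum.Base using (_⊎_; inj₁; inj₂; [_,_]′)
open import Data.Vec.Functional as Vector using (Vector; head; tail)
open import Data.Vec.Functional.Properties using (lookup-++ˡ; lookup-++ʳ)
open import Level using (Level; _⊔_)
open import Relation.Binary.PropositionalEquality as ≡ using (_≡_)
open import Relation.Nullary using (¬_; Dec; yes; no)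
open import Relation.Nullary.Decidable using (¬?; decidable-stable)
open import Relation.Unary using (Pred; _⊆_; _∩_; _≐_; ⋂)

-- Both comparisons of coefficients are instances of `laurent-∩`, about a relation v w = p. Over a
-- ring of fractions p is invertible and w⁻¹ = v p⁻¹, so Laurent polynomials in w become Laurent
-- polynomials in v. The part of degree -n in v of an element of T[w±¹] is h wⁿ with h in T, so its
-- coefficient is h pⁿ. In the first comparison S = T = R[x₁±¹], and every h wⁿ lies in the target.
-- In the second, S = R[x₂] is smaller than T = R[x₂±¹]: h might have a pole at x₂ = 0, but h qⁿ has
-- none, and q(0) = 1 then excludes the pole. The general algebra is done over any Heyting field,
-- where the vanishing of a coefficient cannot be tested. Hence polynomials are carried in Horner
-- form, descents run on the exponent of a denominator, and transcendence speaks of constant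
-- coefficients. Decidability enters only through polynomials over ℚ, to obtain the independence of
-- the initial variables and apartness of all xₖ from zero.

module IntegerSolver {c ℓ : Level} (R : CommutativeRing c ℓ) where

  open CommutativeRing R hiding (zero)
  open import Algebra.Properties.Ring ring
  open import Algebra.Properties.AbelianGroup +-abelianGroup
    using (⁻¹-∙-comm)
  open import Algebra.Properties.CommutativeSemigroup
    +-commutativeSemigroup using (interchange)
  open import Algebra.Properties.Semiring.Mult.TCOptimised semiring
    renaming (_×_ to _×′_)
  open import Algebra.Solver.Ring.AlmostCommutativeRing
    using (fromCommutativeRing; _-Raw-AlmostCommutative⟶_)
  open import Relation.Binary.Reasoning.Setoid setoid

  -- With the optimised multiple, `fromℤ 1ℤ` reduces to `1#`, so `con 1ℤ` in a solver equation
  -- matches `1#` definitionally.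
  fromℤ : ℤ → Carrier
  fromℤ (+ n)    = n ×′ 1#
  fromℤ -[1+ n ] = - (suc n ×′ 1#)

  fromℤ-neg : ∀ i → fromℤ (ℤ.- i) ≈ - fromℤ i
  fromℤ-neg (+ zero)    = sym -0#≈0#
  fromℤ-neg (+ (suc n)) = refl
  fromℤ-neg -[1+ n ]    = sym (-‿involutive _)

  fromℤ-⊖ : ∀ m n → fromℤ (m ℤ.⊖ n) ≈ m ×′ 1# - n ×′ 1#
  fromℤ-⊖ m       zero    = sym (trans (+-congˡ -0#≈0#) (+-identityʳ _))
  fromℤ-⊖ zero    (suc n) = sym (+-identityˡ _)
  fromℤ-⊖ (suc m) (suc n) = begin
    fromℤ (suc m ℤ.⊖ suc n)             ≡⟨ ≡.cong fromℤ (ℤ.[1+m]⊖[1+n]≡m⊖n m n) ⟩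
    fromℤ (m ℤ.⊖ n)                     ≈⟨ fromℤ-⊖ m n ⟩
    m ×′ 1# - n ×′ 1#                     ≈⟨ +-identityˡ _ ⟨
    0# + (m ×′ 1# - n ×′ 1#)              ≈⟨ +-congʳ (-‿inverseʳ 1#) ⟨
    1# - 1# + (m ×′ 1# - n ×′ 1#)         ≈⟨ interchange _ _ _ _ ⟩
    1# + m ×′ 1# + (- 1# - n ×′ 1#)       ≈⟨ +-congˡ (⁻¹-∙-comm _ _) ⟩
    1# + m ×′ 1# - (1# + n ×′ 1#)         ≈⟨ +-cong (1+× m 1#) (-‿cong (1+× n 1#)) ⟨
    suc m ×′ 1# - suc n ×′ 1#             ∎

  fromℤ-+ : ∀ i j → fromℤ (i ℤ.+ j) ≈ fromℤ i + fromℤ j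
  fromℤ-+ (+ m)    (+ n)    = ×-homo-+ 1# m n
  fromℤ-+ (+ m)    -[1+ n ] = fromℤ-⊖ m (suc n)
  fromℤ-+ -[1+ m ] (+ n)    = trans (fromℤ-⊖ n (suc m)) (+-comm _ _)
  fromℤ-+ -[1+ m ] -[1+ n ] = begin
    - (suc (suc (m ℕ.+ n)) ×′ 1#)        ≡⟨ ≡.cong (λ k → - (k ×′ 1#)) (ℕ.+-suc (suc m) n) ⟨
    - ((suc m ℕ.+ suc n) ×′ 1#)          ≈⟨ -‿cong (×-homo-+ 1# (suc m) (suc n)) ⟩
    - (suc m ×′ 1# + suc n ×′ 1#)         ≈⟨ ⁻¹-∙-comm _ _ ⟨
    - (suc m ×′ 1#) - suc n ×′ 1#         ∎

  fromℤ-*⁺ : ∀ m j → fromℤ (+ m ℤ.* j) ≈ m ×′ 1# * fromℤ j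
  fromℤ-*⁺ m (+ n)    = trans
    (reflexive (≡.cong fromℤ (≡.sym (ℤ.pos-* m n)))) (×1-homo-* m n)
  fromℤ-*⁺ m -[1+ n ] = begin
    fromℤ (+ m ℤ.* -[1+ n ])            ≡⟨ ≡.cong fromℤ (ℤ.neg-distribʳ-* (+ m) (+ suc n)) ⟨
    fromℤ (ℤ.- (+ m ℤ.* + suc n))       ≈⟨ fromℤ-neg (+ m ℤ.* + suc n) ⟩
    - fromℤ (+ m ℤ.* + suc n)           ≈⟨ -‿cong (fromℤ-*⁺ m (+ suc n)) ⟩
    - (m ×′ 1# * suc n ×′ 1#)             ≈⟨ -‿distribʳ-* _ _ ⟩
    m ×′ 1# * - (suc n ×′ 1#)             ∎

  fromℤ-* : ∀ i j → fromℤ (i ℤ.* j) ≈ fromℤ i * fromℤ j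
  fromℤ-* (+ m)    j = fromℤ-*⁺ m j
  fromℤ-* -[1+ m ] j = begin
    fromℤ (-[1+ m ] ℤ.* j)              ≡⟨ ≡.cong fromℤ (ℤ.neg-distribˡ-* (+ suc m) j) ⟨
    fromℤ (ℤ.- (+ suc m ℤ.* j))         ≈⟨ fromℤ-neg (+ suc m ℤ.* j) ⟩
    - fromℤ (+ suc m ℤ.* j)             ≈⟨ -‿cong (fromℤ-*⁺ (suc m) j) ⟩
    - (suc m ×′ 1# * fromℤ j)            ≈⟨ -‿distribˡ-* _ _ ⟩
    - (suc m ×′ 1#) * fromℤ j            ∎

  fromℤ-morphism : ℤ.+-*-rawRing -Raw-AlmostCommutative⟶ fromCommutativeRing R
  fromℤ-morphism = record
    { ⟦_⟧    = fromℤ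
    ; +-homo = fromℤ-+
    ; *-homo = fromℤ-*
    ; -‿homo = fromℤ-neg
    ; 0-homo = refl
    ; 1-homo = refl
    }

  private
    fromℤ-≟ : ∀ i j → Maybe (fromℤ i ≈ fromℤ j)
    fromℤ-≟ i j with i ℤ.≟ j
    ... | yes ≡.refl = just refl
    ... | no  _      = nothing

  open import Algebra.Solver.Ring
    ℤ.+-*-rawRing (fromCommutativeRing R) fromℤ-morphism fromℤ-≟ public
    using (solve; _:=_; _:+_; _:*_; :-_; _:-_; con)

-- Subrings, adjunction, localisation and transcendence

module Subrings {c a ℓ : Level} (F : HeytingField c a ℓ) where

  open HeytingField F hiding (zero)
  private
    commutativeRing : CommutativeRing c a
    commutativeRing =
      HeytingCommutativeRing.commutativeRing heytingCommutativeRing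
  open CommutativeRing commutativeRing public
    using (semiring; commutativeSemiring)
  open CommutativeRing commutativeRing using (ring)
  open IntegerSolver commutativeRing public
  open import Algebra.Apartness.Properties.HeytingCommutativeRing
    heytingCommutativeRing public
    using (#-congʳ; 1#0; x#0y#0→xy#0; x-0≈x)
  open import Algebra.Properties.Ring ring public
    using (+-cancelʳ)
  open import Algebra.Properties.Semiring.Exp semiring public
    using (_^_; ^-homo-*; ^-congˡ)
  open import Algebra.Properties.CommutativeSemiring.Exp commutativeSemiring
    public using (^-distrib-*)

  private variable
    s t d : Level
    S S′ : Pred Carrier s
    T : Pred Carrier t
    D : Pred Carrier d
    u v w x y z q r f g : Carrier

  -- Lets the ring solver use a hypothesis: x ≈ y follows from z ≈ w once
  -- x - y = z - w is an identity.
  using-≈ : z ≈ w → x + w ≈ y + z → x ≈ y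
  using-≈ z≈w h = +-cancelʳ _ _ _ (trans h (+-congˡ z≈w))

  reciprocal : y # 0# → ∃[ z ] y * z ≈ 1#
  reciprocal y#0 with #⇒invertible y#0
  ... | z , _ , y*z≈1 = z , trans (*-congʳ (sym (x-0≈x _))) y*z≈1

  invertible⇒#0 : y * z ≈ 1# → y # 0#
  invertible⇒#0 {y} {z} y*z≈1 = invertible⇒#
    (z , trans (*-comm _ _) y*z≈1′ , y*z≈1′)
    where
    y*z≈1′ : (y - 0#) * z ≈ 1#
    y*z≈1′ = trans (*-congʳ (x-0≈x y)) y*z≈1

  *-cancel-#0 : x # 0# → x * y ≈ x * z → y ≈ z
  *-cancel-#0 {x} {y} {z} x#0 xy≈xz with reciprocal x#0
  ... | x⁻¹ , x*x⁻¹≈1 = begin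
    y               ≈⟨ trans (*-congʳ x*x⁻¹≈1) (*-identityˡ y) ⟨
    x * x⁻¹ * y     ≈⟨ solve 3 (λ x i y → x :* i :* y := i :* (x :* y)) refl x x⁻¹ y ⟩
    x⁻¹ * (x * y)   ≈⟨ *-congˡ xy≈xz ⟩
    x⁻¹ * (x * z)   ≈⟨ solve 3 (λ x i y → x :* i :* y := i :* (x :* y)) refl x x⁻¹ z ⟨
    x * x⁻¹ * z     ≈⟨ trans (*-congʳ x*x⁻¹≈1) (*-identityˡ z) ⟩
    z               ∎
    where open import Relation.Binary.Reasoning.Setoid setoid

  *≈0⇒≈0 : x # 0# → x * y ≈ 0# → y ≈ 0#
  *≈0⇒≈0 {x} x#0 xy≈0 = *-cancel-#0 x#0 (trans xy≈0 (sym (zeroʳ x)))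

  ^-#0 : y # 0# → ∀ n → y ^ n # 0#
  ^-#0 y#0 zero    = 1#0
  ^-#0 y#0 (suc n) = x#0y#0→xy#0 y#0 (^-#0 y#0 n)

  1^n≈1 : ∀ n → 1# ^ n ≈ 1#
  1^n≈1 zero    = refl
  1^n≈1 (suc n) = trans (*-identityˡ _) (1^n≈1 n)

  ^-inverse : y * z ≈ 1# → ∀ n → y ^ n * z ^ n ≈ 1#
  ^-inverse {y} {z} yz≈1 n =
    trans (sym (^-distrib-* y z n)) (trans (^-congˡ n yz≈1) (1^n≈1 n))

  cancel-power : y * z ≈ 1# → ∀ n → q ≈ y ^ n → z ^ n * (q * x) ≈ x
  cancel-power {y} {z} {q} {x} yz≈1 n q≈yⁿ = begin
    z ^ n * (q * x)       ≈⟨ *-congˡ (*-congʳ q≈yⁿ) ⟩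
    z ^ n * (y ^ n * x)   ≈⟨ solve 3 (λ i p x → i :* (p :* x) := p :* i :* x)
                               refl (z ^ n) (y ^ n) x ⟩
    y ^ n * z ^ n * x     ≈⟨ *-congʳ (^-inverse yz≈1 n) ⟩
    1# * x                ≈⟨ *-identityˡ x ⟩
    x                     ∎
    where open import Relation.Binary.Reasoning.Setoid setoid

  record IsSubring (S : Pred Carrier s) : Set (c ⊔ a ⊔ s) where
    field
      ≈∈ : x ≈ y → S x → S y
      0∈   : S 0#
      1∈   : S 1#
      -∈   : S x → S (- x)
      +∈   : S x → S y → S (x + y)
      *∈   : S x → S y → S (x * y)

    ^∈ : S x → ∀ n → S (x ^ n)
    ^∈ x∈ zero    = 1∈
    ^∈ x∈ (suc n) = *∈ x∈ (^∈ x∈ n)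

    ≈0∈ : x ≈ 0# → S x
    ≈0∈ x≈0 = ≈∈ (sym x≈0) 0∈

  -- The ring S[v], in Horner form.
  data _[_] (S : Pred Carrier s) (v : Carrier) : Pred Carrier (c ⊔ a ⊔ s) where
    nil  : y ≈ 0# → (S [ v ]) y
    cons : S r → (S [ v ]) f → y ≈ r + v * f → (S [ v ]) y

  adjoin-map : S ⊆ S′ → S [ v ] ⊆ S′ [ v ]
  adjoin-map S⊆S′ (nil e)       = nil e
  adjoin-map S⊆S′ (cons r∈ p e) = cons (S⊆S′ r∈) (adjoin-map S⊆S′ p) e

  adjoin-least : IsSubring T → S ⊆ T → T v → S [ v ] ⊆ T
  adjoin-least T-ring S⊆T v∈ (nil e)       = IsSubring.≈0∈ T-ring e
  adjoin-least T-ring S⊆T v∈ (cons r∈ p e) = ≈∈ (sym e)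
    (+∈ (S⊆T r∈) (*∈ v∈ (adjoin-least T-ring S⊆T v∈ p)))
    where open IsSubring T-ring

  module _ {S : Pred Carrier s} (S-ring : IsSubring S) where

    open IsSubring S-ring

    adjoin-const : S ⊆ S [ v ]
    adjoin-const {v} {y} y∈ = cons y∈ (nil refl)
      (solve 2 (λ y v → y := y :+ v :* con 0ℤ) refl y v)

    adjoin-var : (S [ v ]) v
    adjoin-var {v} = cons 0∈ (adjoin-const 1∈)
      (solve 1 (λ v → v := con 0ℤ :+ v :* con 1ℤ) refl v)

    private
      adjoin-resp : x ≈ y → (S [ v ]) x → (S [ v ]) y
      adjoin-resp x≈y (nil e)       = nil (trans (sym x≈y) e)
      adjoin-resp x≈y (cons r∈ p e) = cons r∈ p (trans (sym x≈y) e)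

      adjoin-+ : (S [ v ]) x → (S [ v ]) y → (S [ v ]) (x + y)
      adjoin-+ (nil e) q = adjoin-resp
        (sym (trans (+-congʳ e) (+-identityˡ _))) q
      adjoin-+ p@(cons _ _ _) (nil e) = adjoin-resp
        (sym (trans (+-congˡ e) (+-identityʳ _))) p
      adjoin-+ {v} (cons {r} {f} r∈ p e) (cons {r′} {f′} r′∈ p′ e′) =
        cons (+∈ r∈ r′∈) (adjoin-+ p p′) (trans (+-cong e e′)
          (solve 5 (λ v r f r′ f′ →
             (r :+ v :* f) :+ (r′ :+ v :* f′) :=
             (r :+ r′) :+ v :* (f :+ f′)) refl v r f r′ f′))

      adjoin-scale : S x → (S [ v ]) y → (S [ v ]) (x * y)
      adjoin-scale x∈ (nil e) = nil (trans (*-congˡ e) (zeroʳ _))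
      adjoin-scale {x} {v} x∈ (cons {r} {f} r∈ p e) =
        cons (*∈ x∈ r∈) (adjoin-scale x∈ p) (trans (*-congˡ e)
          (solve 4 (λ x v r f →
             x :* (r :+ v :* f) := x :* r :+ v :* (x :* f)) refl x v r f))

      adjoin-* : (S [ v ]) x → (S [ v ]) y → (S [ v ]) (x * y)
      adjoin-* (nil e) q = nil (trans (*-congʳ e) (zeroˡ _))
      adjoin-* {v} {x} {y} (cons {r} {f} r∈ p e) q = adjoin-resp
        (trans (solve 4 (λ v r f y →
                  r :* y :+ (con 0ℤ :+ v :* (f :* y)) :=
                  (r :+ v :* f) :* y) refl v r f y)
               (*-congʳ (sym e)))
        (adjoin-+ (adjoin-scale r∈ q) (cons 0∈ (adjoin-* p q) refl))

      adjoin-neg : (S [ v ]) x → (S [ v ]) (- x)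
      adjoin-neg {v} {x} p = adjoin-resp
        (solve 1 (λ x → :- con 1ℤ :* x := :- x) refl x)
        (adjoin-scale (-∈ 1∈) p)

    adjoin-isSubring : IsSubring (S [ v ])
    adjoin-isSubring = record
      { ≈∈ = adjoin-resp
      ; 0∈   = nil refl
      ; 1∈   = adjoin-const 1∈
      ; -∈   = adjoin-neg
      ; +∈   = adjoin-+
      ; *∈   = adjoin-*
      }

  -- All elements already live in a field, so a fraction is an element that some denominator carries
  -- into `S`. Nothing makes `q` invertible here; lemmas that divide by it assume so.
  Loc : Pred Carrier s → Pred Carrier d → Pred Carrier (c ⊔ s ⊔ d)
  Loc S D y = ∃[ q ] D q × S (q * y)

  record IsDenominators (S : Pred Carrier s) (D : Pred Carrier d) :
         Set (c ⊔ s ⊔ d) where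
    field
      D⊆S : D ⊆ S
      1∈D : D 1#
      *∈D : D x → D y → D (x * y)

  Nonzero : Pred Carrier s → Pred Carrier (s ⊔ ℓ)
  Nonzero S = S ∩ (_# 0#)

  Powers : Carrier → Pred Carrier a
  Powers v q = ∃[ n ] q ≈ v ^ n

  Frac : Pred Carrier s → Pred Carrier (c ⊔ s ⊔ ℓ)
  Frac S = Loc S (Nonzero S)

  _[_±¹] : Pred Carrier s → Carrier → Pred Carrier (c ⊔ a ⊔ s)
  S [ v ±¹] = Loc (S [ v ]) (Powers v)

  module _ {S : Pred Carrier s} {D : Pred Carrier d}
           (S-ring : IsSubring S) (D-den : IsDenominators S D) where

    open IsSubring S-ring
    open IsDenominators D-den

    loc-const : S ⊆ Loc S D
    loc-const y∈ = 1# , 1∈D , *∈ 1∈ y∈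

    loc-isSubring : IsSubring (Loc S D)
    loc-isSubring = record
      { ≈∈ = λ { x≈y (q , q∈ , qx∈) → q , q∈ , ≈∈ (*-congˡ x≈y) qx∈ }
      ; 0∈   = loc-const 0∈
      ; 1∈   = loc-const 1∈
      ; -∈   = λ { {x} (q , q∈ , qx∈) → q , q∈ , ≈∈
                 (solve 2 (λ q x → :- (q :* x) := q :* :- x) refl q x)
                 (-∈ qx∈) }
      ; +∈   = λ { {x} {y} (q , q∈ , qx∈) (r , r∈ , ry∈) →
                 q * r , *∈D q∈ r∈ , ≈∈
                 (solve 4 (λ q r x y →
                    r :* (q :* x) :+ q :* (r :* y) :=
                    q :* r :* (x :+ y)) refl q r x y)
                 (+∈ (*∈ (D⊆S r∈) qx∈) (*∈ (D⊆S q∈) ry∈)) }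
      ; *∈   = λ { {x} {y} (q , q∈ , qx∈) (r , r∈ , ry∈) →
                 q * r , *∈D q∈ r∈ , ≈∈
                 (solve 4 (λ q r x y →
                    q :* x :* (r :* y) := q :* r :* (x :* y)) refl q r x y)
                 (*∈ qx∈ ry∈) }
      }

    clear-denominators : (Loc S D [ v ]) f → ∃[ q ] D q × (S [ v ]) (q * f)
    clear-denominators (nil e) =
      1# , 1∈D , nil (trans (*-identityˡ _) e)
    clear-denominators {v} {f} (cons {r} {g} (q , q∈ , qr∈) p e)
      with clear-denominators p
    ... | q′ , q′∈ , p′ = q′ * q , *∈D q′∈ q∈ ,
      cons (*∈ (D⊆S q′∈) qr∈)
           (IsSubring.*∈ (adjoin-isSubring S-ring)
             (adjoin-const S-ring (D⊆S q∈)) p′)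
           (trans (*-congˡ e) (solve 5 (λ q q′ r v g →
              q′ :* q :* (r :+ v :* g) :=
              q′ :* (q :* r) :+ v :* (q :* (q′ :* g))) refl q q′ r v g))

  nonzero-isDenominators : IsSubring S → IsDenominators S (Nonzero S)
  nonzero-isDenominators S-ring = record
    { D⊆S = proj₁
    ; 1∈D = 1∈ , 1#0
    ; *∈D = λ (x∈ , x#0) (y∈ , y#0) → *∈ x∈ y∈ , x#0y#0→xy#0 x#0 y#0
    }
    where open IsSubring S-ring

  powers-isDenominators : IsSubring S → S v → IsDenominators S (Powers v)
  powers-isDenominators {v = v} S-ring v∈ = record
    { D⊆S = λ (n , q≈vⁿ) → ≈∈ (sym q≈vⁿ) (^∈ v∈ n)
    ; 1∈D = 0 , refl
    ; *∈D = λ (m , q≈vᵐ) (n , r≈vⁿ) →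
              m ℕ.+ n , trans (*-cong q≈vᵐ r≈vⁿ) (sym (^-homo-* v m n))
    }
    where open IsSubring S-ring

  module _ (S-ring : IsSubring S) where

    frac-isSubring : IsSubring (Frac S)
    frac-isSubring = loc-isSubring S-ring (nonzero-isDenominators S-ring)

    frac-const : S ⊆ Frac S
    frac-const = loc-const S-ring (nonzero-isDenominators S-ring)

    -- If q y is in `S`, then q y is a denominator for z, because (q y) z = q.
    frac-inverse : y * z ≈ 1# → Frac S y → Frac S z
    frac-inverse {y} {z} yz≈1 (q , (q∈ , q#0) , qy∈) =
      q * y , (qy∈ , x#0y#0→xy#0 q#0 (invertible⇒#0 yz≈1)) , ≈∈
        (sym (trans (*-assoc q y z) (trans (*-congˡ yz≈1) (*-identityʳ q)))) q∈
      where open IsSubring S-ring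

    private
      [v]-ring : IsSubring (S [ v ])
      [v]-ring = adjoin-isSubring S-ring

      v-powers : IsDenominators (S [ v ]) (Powers v)
      v-powers = powers-isDenominators [v]-ring (adjoin-var S-ring)

    laurent-isSubring : IsSubring (S [ v ±¹])
    laurent-isSubring = loc-isSubring [v]-ring v-powers

    adjoin⊆laurent : S [ v ] ⊆ S [ v ±¹]
    adjoin⊆laurent = loc-const [v]-ring v-powers

    laurent-const : S ⊆ S [ v ±¹]
    laurent-const y∈ = adjoin⊆laurent (adjoin-const S-ring y∈)

    laurent-var : (S [ v ±¹]) v
    laurent-var = adjoin⊆laurent (adjoin-var S-ring)

    laurent-inverse : v * z ≈ 1# → (S [ v ±¹]) z
    laurent-inverse {v} {z} vz≈1 =
      v , (1 , sym (*-identityʳ v)) ,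
      IsSubring.≈∈ [v]-ring (sym vz≈1) (IsSubring.1∈ [v]-ring)

    laurent⊆frac : v # 0# → S [ v ±¹] ⊆ Frac (S [ v ])
    laurent⊆frac v#0 (q , (n , q≈vⁿ) , qy∈) =
      q , (IsDenominators.D⊆S v-powers (n , q≈vⁿ) ,
           #-congʳ (sym q≈vⁿ) (^-#0 v#0 n)) , qy∈

  laurent-least : IsSubring T → S ⊆ T → T v → ∀ {v⁻¹} → v * v⁻¹ ≈ 1# → T v⁻¹ →
                  S [ v ±¹] ⊆ T
  laurent-least {v = v} T-ring S⊆T v∈ {v⁻¹} vv⁻¹≈1 v⁻¹∈ {y}
                (q , (n , q≈vⁿ) , qy∈) = ≈∈
    (cancel-power vv⁻¹≈1 n q≈vⁿ)
    (*∈ (^∈ v⁻¹∈ n) (adjoin-least T-ring S⊆T v∈ qy∈))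
    where open IsSubring T-ring

  -- Only the constant coefficient is asked to vanish: if v # 0, the relation
  -- can then be divided by v.
  Transcendental : Pred Carrier s → Carrier → Set (c ⊔ a ⊔ s)
  Transcendental S v =
    ∀ {r f} → S r → (S [ v ]) f → r + v * f ≈ 0# → r ≈ 0#

  transcendental-⊆ : S ⊆ S′ → Transcendental S′ v → Transcendental S v
  transcendental-⊆ S⊆S′ tr r∈ p = tr (S⊆S′ r∈) (adjoin-map S⊆S′ p)

  -- Multiplying the relation by a denominator of r and a common denominator of the coefficients of
  -- f moves it to `S`; both factors are apart from zero and cancel afterwards.
  transcendental-frac : IsSubring S → Transcendental S v →
                        Transcendental (Frac S) v
  transcendental-frac {S = S} {v = v} S-ring tr {r} {f}
    (q , (q∈ , q#0) , qr∈) p h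
    with clear-denominators S-ring (nonzero-isDenominators S-ring) p
  ... | q′ , (q′∈ , q′#0) , p′ = *≈0⇒≈0 q#0 (*≈0⇒≈0 q′#0
    (tr (*∈ q′∈ qr∈)
        (IsSubring.*∈ (adjoin-isSubring S-ring) (adjoin-const S-ring q∈) p′)
        (using-≈ (*-congˡ h) (solve 5 (λ q q′ r v f →
           q′ :* (q :* r) :+ v :* (q :* (q′ :* f)) :+ q :* q′ :* con 0ℤ :=
           con 0ℤ :+ q :* q′ :* (r :+ v :* f)) refl q q′ r v f))))
    where open IsSubring S-ring

  Independent : Pred Carrier s → Carrier → Carrier → Set (c ⊔ a ⊔ s)
  Independent S u v = Transcendental S u × Transcendental (S [ u ]) v

  module _ {S : Pred Carrier s} (S-ring : IsSubring S) where

    private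
      Sᵤ-ring : IsSubring (S [ u ])
      Sᵤ-ring = adjoin-isSubring S-ring

      adjoin-swap : (S [ v ]) [ u ] ⊆ (S [ u ]) [ v ]
      adjoin-swap = adjoin-least (adjoin-isSubring Sᵤ-ring)
        (adjoin-map (adjoin-const S-ring))
        (adjoin-const Sᵤ-ring (adjoin-var S-ring))

    -- Reorder r + u f = 0 by powers of v. Transcendence of v gives r₀ + u f₀ = 0, and that of u
    -- gives r₀ = 0. The rest is v times the same relation for the tails, so dividing by v allows
    -- recursion.
    independent-swap : v # 0# → Independent S u v → Independent S v u
    independent-swap {v} {u} v#0 (tr-u , tr-v) =
      transcendental-⊆ (adjoin-const S-ring) tr-v ,
      λ s∈ p → constant s∈ (adjoin-swap p)
      where
      constant : (S [ v ]) r → ((S [ u ]) [ v ]) f → r + u * f ≈ 0# → r ≈ 0#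
      constant (nil e) _ _ = e
      constant {r} {f} (cons _ _ _) (nil e) h =
        trans (sym (+-identityʳ r))
          (trans (+-congˡ (sym (trans (*-congˡ e) (zeroʳ u)))) h)
      constant {r} {f} (cons {r₀} {r₁} r₀∈ r₁∈ e) (cons {f₀} {f₁} f₀∈ f₁∈ e′) h =
        trans e (trans (+-cong r₀≈0 (trans (*-congˡ r₁≈0) (zeroʳ v)))
                       (+-identityʳ 0#))
        where
        open IsSubring (adjoin-isSubring (Sᵤ-ring {u}) {v})
        h′ : (r₀ + u * f₀) + v * (r₁ + u * f₁) ≈ 0#
        h′ = trans (solve 6 (λ r₀ u f₀ v r₁ f₁ →
               (r₀ :+ u :* f₀) :+ v :* (r₁ :+ u :* f₁) :=
               (r₀ :+ v :* r₁) :+ u :* (f₀ :+ v :* f₁))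
               refl r₀ u f₀ v r₁ f₁)
               (trans (+-cong (sym e) (*-congˡ (sym e′))) h)
        h₀ : r₀ + u * f₀ ≈ 0#
        h₀ = tr-v
          (IsSubring.+∈ Sᵤ-ring (adjoin-const S-ring r₀∈)
            (IsSubring.*∈ Sᵤ-ring (adjoin-var S-ring) f₀∈))
          (+∈ (adjoin-map (adjoin-const S-ring) r₁∈)
            (*∈ (adjoin-const Sᵤ-ring (adjoin-var S-ring)) f₁∈)) h′
        r₀≈0 : r₀ ≈ 0#
        r₀≈0 = tr-u r₀∈ f₀∈ h₀
        h₁ : r₁ + u * f₁ ≈ 0#
        h₁ = *≈0⇒≈0 v#0 (trans (sym (+-identityˡ _)) (trans (+-congʳ (sym h₀)) h′))
        r₁≈0 : r₁ ≈ 0#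
        r₁≈0 = constant r₁∈ f₁∈ h₁

-- Exchange relations v w = p and comparison of coefficients

module Mutation {c a ℓ : Level} (F : HeytingField c a ℓ) where
  open HeytingField F hiding (zero)
  open Subrings F
  open import Relation.Binary.Reasoning.Setoid setoid

  private variable
    s : Level
    S : Pred Carrier s
    u v w y z q r f g : Carrier

  -- S[v] ∩ wS[w] = 0 if vw ∈ S: multiplying by v lowers the degree in w.
  -- The factor q absorbs the powers of vw that appear.
  separate : IsSubring S → Transcendental S v → v # 0# →
             ∀ {p} → v * w ≈ p → S p → S q → (S [ v ]) f → (S [ w ]) g →
             f + q * (w * g) ≈ 0# → f ≈ 0#
  separate {q = q} {f = f} S-ring tr v#0 vw≈p p∈ q∈ f∈ (nil e) h = begin
    f                   ≈⟨ +-identityʳ f ⟨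
    f + 0#              ≈⟨ +-congˡ (trans (*-congˡ (trans (*-congˡ e) (zeroʳ _))) (zeroʳ q)) ⟨
    f + q * (_ * _)     ≈⟨ h ⟩
    0#                  ∎
  separate {S = S} {v = v} {w = w} {q = q} {f = f} {g = g}
           S-ring tr v#0 {p} vw≈p p∈ q∈ f∈ (cons {t} {g′} t∈ g′∈ e) h =
    *≈0⇒≈0 v#0 (trans (sym (+-identityˡ _)) (trans (+-congʳ (sym c≈0)) c+vf≈0))
    where
    open IsSubring S-ring
    c∈ : S (q * p * t)
    c∈ = *∈ (*∈ q∈ p∈) t∈
    c+vf≈0 : q * p * t + v * f ≈ 0#
    c+vf≈0 = separate S-ring tr v#0 vw≈p p∈ (*∈ q∈ p∈)
      (cons c∈ f∈ refl) g′∈ (begin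
        q * p * t + v * f + q * p * (w * g′)
          ≈⟨ solve 7 (λ q p t v f w g′ →
               q :* p :* t :+ v :* f :+ q :* p :* (w :* g′) :=
               v :* f :+ q :* p :* (t :+ w :* g′)) refl q p t v f w g′ ⟩
        v * f + q * p * (t + w * g′)
          ≈⟨ +-congˡ (*-cong (*-congˡ vw≈p) e) ⟨
        v * f + q * (v * w) * g
          ≈⟨ solve 5 (λ q v f w g →
               v :* f :+ q :* (v :* w) :* g :=
               v :* (f :+ q :* (w :* g))) refl q v f w g ⟩
        v * (f + q * (w * g))
          ≈⟨ trans (*-congˡ h) (zeroʳ v) ⟩
        0# ∎)
    c≈0 : q * p * t ≈ 0#
    c≈0 = tr c∈ f∈ c+vf≈0

  -- A relation r + w f = 0 puts r in S[v] ∩ wS[w]: this is `separate` with q = 1.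
  transcendental-mutation :
    IsSubring S → Transcendental S v → v # 0# →
    ∀ {p} → v * w ≈ p → S p → Transcendental S w
  transcendental-mutation S-ring tr v#0 vw≈p p∈ r∈ f∈ h =
    separate S-ring tr v#0 vw≈p p∈ 1∈ (adjoin-const S-ring r∈) f∈
      (trans (+-congˡ (*-identityˡ _)) h)
    where open IsSubring S-ring

  -- `K` is where p may be inverted. `S` and `T` are kept apart because one application has
  -- coefficients in R[x₂] on the side of v and in R[x₂±¹] on the side of w.
  module _ {s t : Level} {K : Pred Carrier t} {S T : Pred Carrier s}
           (K-ring : IsSubring K) (T-ring : IsSubring T)
           (S-ring : IsSubring S) (S⊆T : S ⊆ T) (T⊆K : T ⊆ K)
           {v w : Carrier} (tr : Transcendental K v)
           (v#0 : v # 0#) (w#0 : w # 0#)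
           {p p⁻¹ : Carrier} (vw≈p : v * w ≈ p) (pp⁻¹≈1 : p * p⁻¹ ≈ 1#)
           (p∈ : K p) (p⁻¹∈ : K p⁻¹)
           where

    private
      module K  = IsSubring K-ring
      module T  = IsSubring T-ring
      module Kᵥ = IsSubring (adjoin-isSubring K-ring {v})
      module L  = IsSubring (laurent-isSubring T-ring {w})

      w⁻¹ : Carrier
      w⁻¹ = v * p⁻¹

      ww⁻¹≈1 : w * w⁻¹ ≈ 1#
      ww⁻¹≈1 = begin
        w * (v * p⁻¹) ≈⟨ solve 3 (λ w v i → w :* (v :* i) := v :* w :* i) refl w v p⁻¹ ⟩
        v * w * p⁻¹   ≈⟨ *-congʳ vw≈p ⟩
        p * p⁻¹       ≈⟨ pp⁻¹≈1 ⟩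
        1#            ∎

      -- The decomposition by degree in v, where w has degree -1. Only the part of degree 0 is
      -- tracked in `T`; the other two are separated off later, so coefficients in `K` suffice for
      -- them.
      record Split (z : Carrier) : Set (c ⊔ a ⊔ s ⊔ t) where
        constructor split
        field
          {h₀ f₀ g₀} : Carrier
          h₀∈ : T h₀
          f₀∈ : (K [ v ]) f₀
          g₀∈ : (K [ w ]) g₀
          eq  : z ≈ h₀ + v * f₀ + w * g₀

      -- Induction on the denominator: the lowest term of z is k = r w⁻ⁿ⁻¹, which lies in vK[v]
      -- because w⁻¹ = v p⁻¹, and z - k needs only wⁿ. When no denominator is left, the constant
      -- coefficient is h₀.
      split-powers : ∀ n {z} → (T [ w ]) (w ^ n * z) → Split z
      split-powers zero {z} (nil e) = split T.0∈ Kᵥ.0∈ (nil refl)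
        (trans (trans (sym (*-identityˡ z)) e)
          (solve 2 (λ v w → con 0ℤ := con 0ℤ :+ v :* con 0ℤ :+ w :* con 0ℤ) refl v w))
      split-powers zero {z} (cons {r} {g} r∈ g∈ e) =
        split r∈ Kᵥ.0∈ (adjoin-map T⊆K g∈)
          (trans (trans (sym (*-identityˡ z)) e)
            (solve 4 (λ v w r g → r :+ w :* g := r :+ v :* con 0ℤ :+ w :* g)
              refl v w r g))
      split-powers (suc n) {z} (nil e) = split-powers n
        (nil (*≈0⇒≈0 w#0 (trans (sym (*-assoc w _ z)) e)))
      split-powers (suc n) {z} (cons {r} {g} r∈ g∈ e) =
        split h₀∈ (Kᵥ.+∈ f₀∈ f′∈) g₀∈ (begin
          z            ≈⟨ solve 2 (λ z k → z := (z :- k) :+ k) refl z k ⟩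
          z - k + k    ≈⟨ +-congʳ eq ⟩
          (h₀ + v * f₀ + w * g₀) + k
                       ≈⟨ solve 8 (λ h v f w g i j r →
                            (h :+ v :* f :+ w :* g) :+ r :* (v :* i :* j) :=
                            h :+ v :* (f :+ i :* j :* r) :+ w :* g)
                            refl h₀ v f₀ w g₀ p⁻¹ (w⁻¹ ^ n) r ⟩
          h₀ + v * (f₀ + p⁻¹ * w⁻¹ ^ n * r) + w * g₀ ∎)
        where
        k : Carrier
        k = r * w⁻¹ ^ suc n
        rest : Split (z - k)
        rest = split-powers n (IsSubring.≈∈ (adjoin-isSubring T-ring)
          (*-cancel-#0 w#0 (begin
            w * g
              ≈⟨ solve 3 (λ w g r → w :* g := (r :+ w :* g) :- r) refl w g r ⟩
            (r + w * g) - r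
              ≈⟨ +-cong e (-‿cong (trans (*-congˡ (^-inverse ww⁻¹≈1 (suc n))) (*-identityʳ r))) ⟨
            w ^ suc n * z - r * (w ^ suc n * w⁻¹ ^ suc n)
              ≈⟨ solve 5 (λ w m z r j →
                   w :* m :* z :- r :* (w :* m :* j) :=
                   w :* (m :* (z :- r :* j)))
                   refl w (w ^ n) z r (w⁻¹ ^ suc n) ⟩
            w * (w ^ n * (z - k)) ∎)) g∈)
        open Split rest
        f′∈ : (K [ v ]) (p⁻¹ * w⁻¹ ^ n * r)
        f′∈ = Kᵥ.*∈ (Kᵥ.*∈ (adjoin-const K-ring p⁻¹∈)
                (Kᵥ.^∈ (Kᵥ.*∈ (adjoin-var K-ring) (adjoin-const K-ring p⁻¹∈)) n))
                (adjoin-const K-ring (T⊆K r∈))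

      split-laurent : (T [ w ±¹]) z → Split z
      split-laurent (q , (n , q≈wⁿ) , qz∈) = split-powers n
        (IsSubring.≈∈ (adjoin-isSubring T-ring) (*-congʳ q≈wⁿ) qz∈)

      -- Since v = p w⁻¹, vⁿ y = pⁿ (w⁻ⁿ y). The factor w⁻ⁿ y stays in T[w±¹], so its part h₀ of
      -- degree 0 lies in `T`, whereas vⁿ y itself has r in degree 0.
      leading-coefficient : ∀ n {r f} → (T [ w ±¹]) y → S r → (S [ v ]) f →
                v ^ n * y ≈ r + v * f →
                ∃[ h ] T h × h * p ^ n ≈ r
      leading-coefficient {y} n {r} {f} y∈ r∈ f∈ e = from-split (split-laurent
        (L.*∈ (L.^∈ (laurent-inverse T-ring ww⁻¹≈1) n) y∈))
        where
        from-split : Split (w⁻¹ ^ n * y) → ∃[ h ] T h × h * p ^ n ≈ r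
        from-split (split {h₀} {f₀} {g₀} h₀∈ f₀∈ g₀∈ eq) = h₀ , h₀∈ , (begin
          h₀ * p ^ n
            ≈⟨ solve 3 (λ h P r → h :* P := (P :* h :- r) :+ r) refl h₀ (p ^ n) r ⟩
          (p ^ n * h₀ - r) + r
            ≈⟨ +-congʳ (tr (K.+∈ (K.*∈ (K.^∈ p∈ n) (T⊆K h₀∈)) (K.-∈ r∈′)) f″∈ ∙≈0) ⟩
          0# + r
            ≈⟨ +-identityˡ r ⟩
          r ∎)
         where
          r∈′ : K r
          r∈′ = T⊆K (S⊆T r∈)
          f″ : Carrier
          f″ = p ^ n * f₀ - f
          f″∈ : (K [ v ]) f″
          f″∈ = Kᵥ.+∈
            (Kᵥ.*∈ (Kᵥ.^∈ (adjoin-const K-ring p∈) n) f₀∈)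
            (Kᵥ.-∈ (adjoin-map (λ s∈ → T⊆K (S⊆T s∈)) f∈))
          vⁿy : v ^ n * y ≈ p ^ n * (h₀ + v * f₀ + w * g₀)
          vⁿy = begin
            v ^ n * y
              ≈⟨ *-identityˡ _ ⟨
            1# * (v ^ n * y)
              ≈⟨ *-congʳ (^-inverse ww⁻¹≈1 n) ⟨
            w ^ n * w⁻¹ ^ n * (v ^ n * y)
              ≈⟨ solve 4 (λ W J V y →
                   W :* J :* (V :* y) := V :* W :* (J :* y))
                   refl (w ^ n) (w⁻¹ ^ n) (v ^ n) y ⟩
            v ^ n * w ^ n * (w⁻¹ ^ n * y)
              ≈⟨ *-cong (trans (sym (^-distrib-* v w n)) (^-congˡ n vw≈p)) eq ⟩
            p ^ n * (h₀ + v * f₀ + w * g₀) ∎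
          ∙≈0 : p ^ n * h₀ - r + v * f″ ≈ 0#
          -- The two expressions for vⁿ y differ by an element of K[v] plus pⁿ w g₀; `separate`
          -- makes the first summand vanish, and transcendence of v then kills its constant
          -- coefficient.
          ∙≈0 = separate K-ring tr v#0 vw≈p p∈ (K.^∈ p∈ n)
            (cons (K.+∈ (K.*∈ (K.^∈ p∈ n) (T⊆K h₀∈)) (K.-∈ r∈′)) f″∈ refl) g₀∈
            (using-≈ (trans (sym vⁿy) e)
              (solve 8 (λ P h r v f′ f w g →
                 (P :* h :- r :+ v :* (P :* f′ :- f)) :+ P :* (w :* g) :+ (r :+ v :* f) :=
                 con 0ℤ :+ P :* (h :+ v :* f′ :+ w :* g))
                 refl (p ^ n) h₀ r v f₀ f w g₀))

    -- Among the Laurent polynomials in v over S, those in T[w±¹] have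
    -- coefficients of v⁻ⁿ divisible by pⁿ in T, and pⁿv⁻ⁿ = wⁿ.
    laurent-∩ : ∀ {b} {B : Pred Carrier b} → IsSubring B → S ⊆ B → B v →
                (∀ {h} n → T h → S (h * p ^ n) → B (h * w ^ n)) →
                (S [ v ±¹]) y → (T [ w ±¹]) y → B y
    laurent-∩ {y} {B = B} B-ring S⊆B v∈B terms (q , (n , q≈vⁿ) , qy∈) =
      go n (IsSubring.≈∈ (adjoin-isSubring S-ring) (*-congʳ q≈vⁿ) qy∈)
      where
      module B = IsSubring B-ring
      go : ∀ n {y} → (S [ v ]) (v ^ n * y) → (T [ w ±¹]) y → B y
      go zero vⁿy∈ _ =
        B.≈∈ (*-identityˡ _) (adjoin-least B-ring S⊆B v∈B vⁿy∈)
      go (suc n) (nil e) _ = B.≈0∈ (*≈0⇒≈0 (^-#0 v#0 (suc n)) e)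
      go (suc n) {y} (cons {r} {f} r∈ f∈ e) y∈ =
        subtract (leading-coefficient (suc n) y∈ r∈ f∈ e)
        where
        subtract : ∃[ h ] T h × h * p ^ suc n ≈ r → B y
        subtract (h , h∈ , hpⁿ≈r) = B.≈∈
          (solve 2 (λ y k → (y :- k) :+ k := y) refl y k)
          (B.+∈ (go n vⁿ[y-k]∈ y-k∈)
            (terms (suc n) h∈ (IsSubring.≈∈ S-ring (sym hpⁿ≈r) r∈)))
         where
          -- As vⁿ⁺¹ wⁿ⁺¹ = pⁿ⁺¹, k equals the lowest term r v⁻ⁿ⁻¹ of y. Subtracting it lowers the
          -- exponent of v without leaving T[w±¹].
          k : Carrier
          k = h * w ^ suc n
          y-k∈ : (T [ w ±¹]) (y - k)
          y-k∈ = L.+∈ y∈ (L.-∈ (L.*∈ (laurent-const T-ring h∈)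
            (L.^∈ (laurent-var T-ring) (suc n))))
          vⁿ[y-k]∈ : (S [ v ]) (v ^ n * (y - k))
          vⁿ[y-k]∈ = IsSubring.≈∈ (adjoin-isSubring S-ring)
            (*-cancel-#0 v#0 (begin
              v * f
                ≈⟨ solve 3 (λ v f r → v :* f := (r :+ v :* f) :- r) refl v f r ⟩
              (r + v * f) - r
                ≈⟨ +-cong e (-‿cong (trans (*-congˡ (trans
                     (sym (^-distrib-* v w (suc n)))
                     (^-congˡ (suc n) vw≈p))) hpⁿ≈r)) ⟨
              v ^ suc n * y - h * (v ^ suc n * w ^ suc n)
                ≈⟨ solve 5 (λ v m y h W →
                     v :* m :* y :- h :* (v :* m :* W) :=
                     v :* (m :* (y :- h :* W)))
                     refl v (v ^ n) y h (w ^ suc n) ⟩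
              v * (v ^ n * (y - k)) ∎)) f∈

  -- The condition that a polynomial in u has constant coefficient 1, in the form in which exchange
  -- polynomials enter the intersection argument.
  One+ : Pred Carrier s → Carrier → Pred Carrier (c ⊔ a ⊔ s)
  One+ S u q = ∃[ g ] (S [ u ]) g × q ≈ 1# + u * g

  module _ {S : Pred Carrier s} (S-ring : IsSubring S) where

    private module Sᵤ {u : Carrier} = IsSubring (adjoin-isSubring S-ring {u})

    one+⊆ : One+ S u ⊆ S [ u ]
    one+⊆ (g , g∈ , e) = cons (IsSubring.1∈ S-ring) g∈ e

    one+-^ : One+ S u q → ∀ n → One+ S u (q ^ n)
    one+-^ {u} {q} h zero = 0# , nil refl ,
      solve 1 (λ u → con 1ℤ := con 1ℤ :+ u :* con 0ℤ) refl u
    one+-^ {u} {q} h@(g , g∈ , e) (suc n) with one+-^ h n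
    ... | g′ , g′∈ , e′ =
      g + g′ + u * g * g′ ,
      Sᵤ.+∈ (Sᵤ.+∈ g∈ g′∈) (Sᵤ.*∈ (Sᵤ.*∈ (adjoin-var S-ring) g∈) g′∈) ,
      trans (*-cong e e′) (solve 3 (λ u g g′ →
        (con 1ℤ :+ u :* g) :* (con 1ℤ :+ u :* g′) :=
        con 1ℤ :+ u :* (g :+ g′ :+ u :* g :* g′)) refl u g g′)

    -- If uⁿ⁺¹ h = r + u f, then uⁿ⁺¹ h q has constant coefficient r because q has constant
    -- coefficient 1. But h q is a polynomial, so that product is divisible by u; hence r = 0 and
    -- the denominator of h drops to uⁿ.
    one+-polynomial : Transcendental S u → u # 0# → One+ S u q →
                      ∀ {h} → (S [ u ±¹]) h → (S [ u ]) (h * q) → (S [ u ]) h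
    one+-polynomial {u} {q} tr u#0 (g , g∈ , e) {h} (d , (n , d≈uⁿ) , dh∈) hq∈ =
      go n (Sᵤ.≈∈ (*-congʳ d≈uⁿ) dh∈)
      where
      go : ∀ n → (S [ u ]) (u ^ n * h) → (S [ u ]) h
      go zero uⁿh∈ = Sᵤ.≈∈ (*-identityˡ h) uⁿh∈
      go (suc n) (nil e′) = Sᵤ.≈0∈ (*≈0⇒≈0 (^-#0 u#0 (suc n)) e′)
      go (suc n) (cons {r} {f} r∈ f∈ e′) = go n (Sᵤ.≈∈
        (*-cancel-#0 u#0 (begin
          u * f             ≈⟨ +-identityˡ _ ⟨
          0# + u * f        ≈⟨ +-congʳ r≈0 ⟨
          r + u * f         ≈⟨ e′ ⟨
          u ^ suc n * h     ≈⟨ *-assoc u _ h ⟩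
          u * (u ^ n * h)   ∎)) f∈)
        where
        f′ : Carrier
        f′ = f + r * g + u * f * g - u ^ n * (h * q)
        r≈0 : r ≈ 0#
        r≈0 = tr {f = f′} r∈
          (Sᵤ.+∈ (Sᵤ.+∈ (Sᵤ.+∈ f∈ (Sᵤ.*∈ (adjoin-const S-ring r∈) g∈))
            (Sᵤ.*∈ (Sᵤ.*∈ (adjoin-var S-ring) f∈) g∈))
            (Sᵤ.-∈ (Sᵤ.*∈ (Sᵤ.^∈ (adjoin-var S-ring) n) hq∈)))
          (begin
            r + u * f′
              ≈⟨ solve 7 (λ r u f g U h q →
                   r :+ u :* (f :+ r :* g :+ u :* f :* g :- U :* (h :* q)) :=
                   (r :+ u :* f) :* (con 1ℤ :+ u :* g) :- u :* U :* h :* q)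
                   refl r u f g (u ^ n) h q ⟩
            (r + u * f) * (1# + u * g) - u ^ suc n * h * q
              ≈⟨ +-congʳ (*-cong e′ e) ⟨
            u ^ suc n * h * q - u ^ suc n * h * q
              ≈⟨ -‿inverseʳ _ ⟩
            0# ∎)

-- The intersection of three consecutive tori

module UpperBound {c a ℓ : Level} (F : HeytingField c a ℓ) where
  open HeytingField F hiding (zero)
  open Subrings F
  open Mutation F
  open import Relation.Binary.Reasoning.Setoid setoid

  module _ {r s : Level} {R : Pred Carrier r} {A : Pred Carrier s}
           (R-ring : IsSubring R) (A-ring : IsSubring A) (R⊆A : R ⊆ A)
           {x₀ x₁ x₂ x₃ p q : Carrier}
           (x₀∈ : A x₀) (x₁∈ : A x₁) (x₂∈ : A x₂) (x₃∈ : A x₃)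
           (x₀#0 : x₀ # 0#) (x₁#0 : x₁ # 0#) (x₂#0 : x₂ # 0#) (x₃#0 : x₃ # 0#)
           (x₂x₀≈p : x₂ * x₀ ≈ p) (p∈ : One+ R x₁ p) (p#0 : p # 0#)
           (x₁x₃≈q : x₁ * x₃ ≈ q) (q∈ : One+ R x₂ q) (q#0 : q # 0#)
           (independent : Independent R x₁ x₂)
           where

    private
      module A = IsSubring A-ring

      -- `E` is R[x₁±¹, x₂] and `G` is R[x₁±¹][x₀, x₂]. In `G` the variable x₀ is adjoined before x₁
      -- is inverted, so that each element has a single denominator x₁ⁿ.
      R₂ R₂₁ E G : Pred Carrier _
      R₂  = R [ x₂ ]
      R₂₁ = R₂ [ x₁ ]
      E   = R₂ [ x₁ ±¹]
      G   = Loc (R₂₁ [ x₀ ]) (Powers x₁)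

      R₂-ring : IsSubring R₂
      R₂-ring = adjoin-isSubring R-ring
      R₂₁-ring : IsSubring R₂₁
      R₂₁-ring = adjoin-isSubring R₂-ring
      R₂₁₀-ring : IsSubring (R₂₁ [ x₀ ])
      R₂₁₀-ring = adjoin-isSubring R₂₁-ring
      E-ring : IsSubring E
      E-ring = laurent-isSubring R₂-ring

      x₁∈R₂₁₀ : (R₂₁ [ x₀ ]) x₁
      x₁∈R₂₁₀ = adjoin-const R₂₁-ring (adjoin-var R₂-ring)
      G-den : IsDenominators (R₂₁ [ x₀ ]) (Powers x₁)
      G-den = powers-isDenominators R₂₁₀-ring x₁∈R₂₁₀
      G-ring : IsSubring G
      G-ring = loc-isSubring R₂₁₀-ring G-den

      module E = IsSubring E-ring
      module G = IsSubring G-ring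

      x₁⁻¹ : Carrier
      x₁⁻¹ = proj₁ (reciprocal x₁#0)
      x₁x₁⁻¹≈1 : x₁ * x₁⁻¹ ≈ 1#
      x₁x₁⁻¹≈1 = proj₂ (reciprocal x₁#0)

      R₂₁⊆A : R₂₁ ⊆ A
      R₂₁⊆A = adjoin-least A-ring (adjoin-least A-ring R⊆A x₂∈) x₁∈

      R₂₁⊆E : R₂₁ ⊆ E
      R₂₁⊆E = adjoin⊆laurent R₂-ring

      p∈R₂₁ : R₂₁ p
      p∈R₂₁ = adjoin-map (adjoin-const R-ring) (one+⊆ R-ring p∈)

      x₁⁻¹∈E : E x₁⁻¹
      x₁⁻¹∈E = laurent-inverse R₂-ring x₁x₁⁻¹≈1

      x₃∈E : E x₃
      x₃∈E = E.≈∈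
        (begin
          x₁⁻¹ * q            ≈⟨ *-congˡ x₁x₃≈q ⟨
          x₁⁻¹ * (x₁ * x₃)    ≈⟨ solve 3 (λ i x y → i :* (x :* y) := x :* i :* y)
                                   refl x₁⁻¹ x₁ x₃ ⟩
          x₁ * x₁⁻¹ * x₃      ≈⟨ *-congʳ x₁x₁⁻¹≈1 ⟩
          1# * x₃             ≈⟨ *-identityˡ x₃ ⟩
          x₃                  ∎)
        (E.*∈ x₁⁻¹∈E (laurent-const R₂-ring (one+⊆ R-ring q∈)))

      -- Only a sum of additive groups: products are available with factors from A ∩ E, such as x₃
      -- and R[x₁, x₂], and with x₀ by a separate argument.
      A+E : Pred Carrier _
      A+E y = ∃₂ λ l e → A l × E e × y ≈ l + e

      A+E-resp : ∀ {x y} → x ≈ y → A+E x → A+E y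
      A+E-resp x≈y (l , e , l∈ , e∈ , eq) = l , e , l∈ , e∈ , trans (sym x≈y) eq

      A+E-+ : ∀ {x y} → A+E x → A+E y → A+E (x + y)
      A+E-+ (l , e , l∈ , e∈ , eq) (l′ , e′ , l′∈ , e′∈ , eq′) =
        l + l′ , e + e′ , A.+∈ l∈ l′∈ , E.+∈ e∈ e′∈ ,
        trans (+-cong eq eq′) (solve 4 (λ l e l′ e′ →
          (l :+ e) :+ (l′ :+ e′) := (l :+ l′) :+ (e :+ e′)) refl l e l′ e′)

      A+E-* : ∀ {x y} → A x → E x → A+E y → A+E (x * y)
      A+E-* {x} x∈A x∈E (l , e , l∈ , e∈ , eq) =
        x * l , x * e , A.*∈ x∈A l∈ , E.*∈ x∈E e∈ ,
        trans (*-congˡ eq) (distribˡ x l e)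

      E⊆A+E : E ⊆ A+E
      E⊆A+E {y} y∈ = 0# , y , A.0∈ , y∈ , sym (+-identityˡ y)

      A⊆A+E : A ⊆ A+E
      A⊆A+E {y} y∈ = y , 0# , y∈ , E.0∈ , sym (+-identityʳ y)

      -- x₁⁻¹ = x₃ - x₂ s x₁⁻¹, where q = 1 + x₂ s, while x₂ x₀ = p ∈ R[x₁].
      x₀x₁⁻ⁿ∈A+E : ∀ n → A+E (x₀ * x₁⁻¹ ^ n)
      x₀x₁⁻ⁿ∈A+E zero    = A⊆A+E (A.*∈ x₀∈ A.1∈)
      x₀x₁⁻ⁿ∈A+E (suc n) = A+E-resp eq (A+E-+
        (A+E-* x₃∈ x₃∈E (x₀x₁⁻ⁿ∈A+E n))
        (E⊆A+E (E.-∈ (E.*∈ (E.*∈ (E.^∈ x₁⁻¹∈E (suc n)) (R₂₁⊆E p∈R₂₁))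
          (laurent-const R₂-ring s∈)))))
        where
        s∈ = proj₁ (proj₂ q∈)
        s₀ : Carrier
        s₀ = proj₁ q∈
        i j : Carrier
        i = x₁⁻¹
        j = x₁⁻¹ ^ n
        eq : x₃ * (x₀ * j) - i * j * p * s₀ ≈ x₀ * (i * j)
        eq = begin
          x₃ * (x₀ * j) - i * j * p * s₀
            ≈⟨ +-cong (trans (*-congʳ x₁x₁⁻¹≈1) (*-identityˡ _))
                      (-‿cong (*-congʳ (*-congˡ x₂x₀≈p))) ⟨
          x₁ * i * (x₃ * (x₀ * j)) - i * j * (x₂ * x₀) * s₀
            ≈⟨ solve 7 (λ x₁ i x₃ x₀ j x₂ s →
                 x₁ :* i :* (x₃ :* (x₀ :* j)) :- i :* j :* (x₂ :* x₀) :* s :=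
                 i :* j :* x₀ :* (x₁ :* x₃ :- x₂ :* s)) refl x₁ i x₃ x₀ j x₂ s₀ ⟩
          i * j * x₀ * (x₁ * x₃ - x₂ * s₀)
            ≈⟨ *-congˡ (+-congʳ (trans x₁x₃≈q (proj₂ (proj₂ q∈)))) ⟩
          i * j * x₀ * (1# + x₂ * s₀ - x₂ * s₀)
            ≈⟨ solve 5 (λ i j x₀ x₂ s →
                 i :* j :* x₀ :* (con 1ℤ :+ x₂ :* s :- x₂ :* s) :=
                 x₀ :* (i :* j)) refl i j x₀ x₂ s₀ ⟩
          x₀ * (i * j) ∎

      -- `A+E-*` would require x₀ in `E`. Instead e is x₁⁻ⁿ times an element of R[x₁, x₂], which
      -- lies in A ∩ E, and only x₀ x₁⁻ⁿ remains to be treated.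
      x₀∙A+E : ∀ {y} → A+E y → A+E (x₀ * y)
      x₀∙A+E {y} (l , e , l∈ , (q , (n , q≈x₁ⁿ) , qe∈) , y≈l+e) = A+E-resp
        (begin
          x₀ * l + q * e * (x₀ * x₁⁻¹ ^ n)
            ≈⟨ solve 5 (λ x l q e i →
                 x :* l :+ q :* e :* (x :* i) :=
                 x :* (l :+ i :* (q :* e))) refl x₀ l q e (x₁⁻¹ ^ n) ⟩
          x₀ * (l + x₁⁻¹ ^ n * (q * e))
            ≈⟨ *-congˡ (+-congˡ (cancel-power x₁x₁⁻¹≈1 n q≈x₁ⁿ)) ⟩
          x₀ * (l + e)
            ≈⟨ *-congˡ y≈l+e ⟨
          x₀ * y ∎)
        (A+E-+ (A⊆A+E (A.*∈ x₀∈ l∈))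
          (A+E-* (R₂₁⊆A qe∈) (R₂₁⊆E qe∈) (x₀x₁⁻ⁿ∈A+E n)))

      G⊆A+E : G ⊆ A+E
      G⊆A+E {y} (q , (n , q≈x₁ⁿ) , qy∈) =
        A+E-resp (cancel-power x₁x₁⁻¹≈1 n q≈x₁ⁿ) (scaled qy∈)
        where
        i : Carrier
        i = x₁⁻¹ ^ n
        scaled : ∀ {f} → (R₂₁ [ x₀ ]) f → A+E (i * f)
        scaled (nil e) = E⊆A+E (E.≈0∈ (trans (*-congˡ e) (zeroʳ i)))
        scaled {f} (cons {t} {g} t∈ g∈ e) = A+E-resp
          (begin
            i * t + x₀ * (i * g)  ≈⟨ solve 4 (λ i t x g →
                                       i :* t :+ x :* (i :* g) :=
                                       i :* (t :+ x :* g)) refl i t x₀ g ⟩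
            i * (t + x₀ * g)      ≈⟨ *-congˡ e ⟨
            i * f                 ∎)
          (A+E-+ (E⊆A+E (E.*∈ (E.^∈ x₁⁻¹∈E n) (R₂₁⊆E t∈))) (x₀∙A+E (scaled g∈)))

      module _ {x : Carrier} (x#0 : x # 0#) where
        Kₓ : Pred Carrier _
        Kₓ = Frac (R [ x ])
        Kₓ-ring : IsSubring Kₓ
        Kₓ-ring = frac-isSubring (adjoin-isSubring R-ring)
        one+∈K : ∀ {p} → One+ R x p → Kₓ p
        one+∈K p∈ = frac-const (adjoin-isSubring R-ring) (one+⊆ R-ring p∈)
        one+⁻¹∈K : ∀ {p p⁻¹} → p * p⁻¹ ≈ 1# → One+ R x p → Kₓ p⁻¹
        one+⁻¹∈K pp⁻¹≈1 p∈ =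
          frac-inverse (adjoin-isSubring R-ring) pp⁻¹≈1 (one+∈K p∈)

      -- The pair v = x₂, w = x₀ over S = T = R[x₁±¹], with p made invertible in the fractions of
      -- R[x₁].
      𝒯₁₂∩𝒯₁₀⊆G : ∀ {y} → ((R [ x₁ ±¹]) [ x₂ ±¹]) y →
                  ((R [ x₁ ±¹]) [ x₀ ±¹]) y → G y
      𝒯₁₂∩𝒯₁₀⊆G = laurent-∩ (Kₓ-ring x₁#0) (laurent-isSubring R-ring)
        (laurent-isSubring R-ring) (λ t∈ → t∈) (laurent⊆frac R-ring x₁#0)
        (transcendental-frac (adjoin-isSubring R-ring) (proj₂ independent))
        x₂#0 x₀#0 x₂x₀≈p (proj₂ (reciprocal p#0))
        (one+∈K x₁#0 p∈) (one+⁻¹∈K x₁#0 (proj₂ (reciprocal p#0)) p∈)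
        G-ring T⊆G x₂∈G
        (λ n h∈ _ → G.*∈ (T⊆G h∈) (G.^∈ x₀∈G n))
        where
        G-const : R₂₁ [ x₀ ] ⊆ G
        G-const = loc-const R₂₁₀-ring G-den
        x₀∈G : G x₀
        x₀∈G = G-const (adjoin-var R₂₁-ring)
        x₂∈G : G x₂
        x₂∈G = G-const (adjoin-const R₂₁-ring
                 (adjoin-const R₂-ring (adjoin-var R-ring)))
        x₁⁻¹∈G : G x₁⁻¹
        x₁⁻¹∈G = x₁ , (1 , sym (*-identityʳ x₁)) ,
          IsSubring.≈∈ R₂₁₀-ring (sym x₁x₁⁻¹≈1) (IsSubring.1∈ R₂₁₀-ring)
        T⊆G : R [ x₁ ±¹] ⊆ G
        T⊆G = laurent-least G-ring
          (λ r∈ → G-const (adjoin-const R₂₁-ring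
            (adjoin-const R₂-ring (adjoin-const R-ring r∈))))
          (G-const x₁∈R₂₁₀) x₁x₁⁻¹≈1 x₁⁻¹∈G

      -- The pair v = x₁, w = x₃ with S = R[x₂] and T = R[x₂±¹]. A coefficient h in T with h qⁿ in
      -- R[x₂] is itself a polynomial, by `one+-polynomial`.
      E∩𝒯₂₃⊆A : ∀ {y} → E y → ((R [ x₂ ±¹]) [ x₃ ±¹]) y → A y
      E∩𝒯₂₃⊆A = laurent-∩ (Kₓ-ring x₂#0) (laurent-isSubring R-ring)
        R₂-ring (adjoin⊆laurent R-ring) (laurent⊆frac R-ring x₂#0)
        (transcendental-frac R₂-ring (proj₂ independent′))
        x₁#0 x₃#0 x₁x₃≈q (proj₂ (reciprocal q#0))
        (one+∈K x₂#0 q∈) (one+⁻¹∈K x₂#0 (proj₂ (reciprocal q#0)) q∈)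
        A-ring (λ t∈ → R₂₁⊆A (adjoin-const R₂-ring t∈)) x₁∈
        (λ n h∈ hqⁿ∈ → A.*∈
          (R₂₁⊆A (adjoin-const R₂-ring
            (one+-polynomial R-ring (proj₁ independent′) x₂#0
              (one+-^ R-ring q∈ n) h∈ hqⁿ∈)))
          (A.^∈ x₃∈ n))
        where
        independent′ : Independent R x₂ x₁
        independent′ = independent-swap R-ring x₂#0 independent

    -- Write y = l + e with l in `A` and e in `E`. As `A` lies in the third torus, e = y - l lies
    -- there too, so e is in `A` as well.
    upper-bound : A ⊆ (R [ x₂ ±¹]) [ x₃ ±¹] →
                  ∀ {y} → ((R [ x₁ ±¹]) [ x₀ ±¹]) y →
                  ((R [ x₁ ±¹]) [ x₂ ±¹]) y →
                  ((R [ x₂ ±¹]) [ x₃ ±¹]) y → A y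
    upper-bound A⊆𝒯₂₃ {y} y∈₁₀ y∈₁₂ y∈₂₃ = conclude (G⊆A+E (𝒯₁₂∩𝒯₁₀⊆G y∈₁₂ y∈₁₀))
      where
      open IsSubring (laurent-isSubring (laurent-isSubring R-ring {x₂}) {x₃})
      conclude : A+E y → A y
      conclude (l , e , l∈ , e∈ , y≈l+e) = A.≈∈ (sym y≈l+e)
        (A.+∈ l∈ (E∩𝒯₂₃⊆A e∈ (≈∈
          (trans (+-congʳ y≈l+e)
            (solve 2 (λ l e → l :+ e :- l := e) refl l e))
          (+∈ y∈₂₃ (-∈ (A⊆𝒯₂₃ l∈))))))

-- The exchange polynomials and their reciprocals

module ExchangePolynomials {c a ℓ : Level} (F : HeytingField c a ℓ) where
  open HeytingField F hiding (zero)
  open Subrings F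
  open Mutation F
  open import Algebra.Properties.Semiring.Sum semiring
    using (sum; sum-cong-≋; *-distribˡ-sum)
  open import Relation.Binary.Reasoning.Setoid setoid

  -- `P` and the numerator of `P̄` for arbitrary coefficient vectors: the inductions pass to `tail`,
  -- which loses the constant coefficient 1 of `coeff`.
  ascending : ∀ {n} → Vector Carrier n → Carrier → Carrier
  ascending q z = sum λ k → q k * z ^ toℕ k

  descending : ∀ {l} → Vector Carrier (suc l) → Carrier → Carrier
  descending {l} q z = sum λ k → q k * z ^ (l ℕ.∸ toℕ k)

  ascending-suc : ∀ {n} (q : Vector Carrier (suc n)) z →
                  ascending q z ≈ q zero + z * ascending (tail q) z
  ascending-suc {n} q z = +-cong (*-identityʳ (q zero)) (trans
    (sum-cong-≋ λ k → solve 3 (λ q z w → q :* (z :* w) := z :* (q :* w))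
      refl (q (suc k)) z (z ^ toℕ k))
    (sym (*-distribˡ-sum z λ k → q (suc k) * z ^ toℕ k)))

  descending-zero : (q : Vector Carrier 1) → ∀ z → descending q z ≈ q zero
  descending-zero q z = trans (+-identityʳ _) (*-identityʳ (q zero))

  inverse-* : ∀ {y} (y#0 : y # 0#) → y * inverse F y#0 ≈ 1#
  inverse-* y#0 = trans (*-congʳ (sym (x-0≈x _)))
    (proj₂ (proj₂ (#⇒invertible y#0)))

  module _ {r : Level} {R : Pred Carrier r} (R-ring : IsSubring R) where

    private
      module Rᵤ {u : Carrier} = IsSubring (adjoin-isSubring R-ring {u})

    ascending∈ : ∀ {n} {q : Vector Carrier n} → (∀ k → R (q k)) → ∀ z →
                 (R [ z ]) (ascending q z)
    ascending∈ {zero}      q∈ z = nil refl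
    ascending∈ {suc n} {q} q∈ z =
      cons (q∈ zero) (ascending∈ (λ k → q∈ (suc k)) z) (ascending-suc q z)

    descending∈ : ∀ {l} {q : Vector Carrier (suc l)} → (∀ k → R (q k)) → ∀ z →
                  ∃[ g ] (R [ z ]) g × descending q z ≈ q (fromℕ l) + z * g
    descending∈ {zero} {q} q∈ z = 0# , nil refl ,
      trans (descending-zero q z)
        (solve 2 (λ q z → q := q :+ z :* con 0ℤ) refl (q zero) z)
    descending∈ {suc l} {q} q∈ z with descending∈ (λ k → q∈ (suc k)) z
    ... | g , g∈ , e =
      q zero * z ^ l + g ,
      Rᵤ.+∈ (Rᵤ.*∈ (adjoin-const R-ring (q∈ zero))
                   (Rᵤ.^∈ (adjoin-var R-ring) l)) g∈ ,
      trans (+-congˡ e)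
        (solve 5 (λ q z w t g →
           q :* (z :* w) :+ (t :+ z :* g) := t :+ z :* (q :* w :+ g))
           refl (q zero) z (z ^ l) (tail q (fromℕ l)) g)

    module _ {l : ℕ} {p : Vector Carrier l} (p∈ : ∀ k → R (p k)) where

      coeff∈ : ∀ k → R (coeff F p k)
      coeff∈ zero    = IsSubring.1∈ R-ring
      coeff∈ (suc k) = p∈ k

      P-one+ : ∀ z → One+ R z (P F p z)
      P-one+ z = ascending p z , ascending∈ p∈ z , ascending-suc (coeff F p) z

      module _ (pₗ#0 : leading F p # 0#) (pₗ⁻¹∈ : R (inverse F pₗ#0)) where

        -- Reversal makes the leading coefficient pₗ the constant one, and the normalisation by pₗ
        -- turns it into 1.
        P̄-one+ : ∀ z → One+ R z (P̄ F p pₗ#0 z)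
        P̄-one+ z with descending∈ coeff∈ z
        ... | g , g∈ , e =
          inverse F pₗ#0 * g , Rᵤ.*∈ (adjoin-const R-ring pₗ⁻¹∈) g∈ ,
          (begin
            descending (coeff F p) z * inverse F pₗ#0
              ≈⟨ *-congʳ e ⟩
            (leading F p + z * g) * inverse F pₗ#0
              ≈⟨ solve 4 (λ p z g i →
                   (p :+ z :* g) :* i := p :* i :+ z :* (i :* g))
                   refl (leading F p) z g (inverse F pₗ#0) ⟩
            leading F p * inverse F pₗ#0 + z * (inverse F pₗ#0 * g)
              ≈⟨ +-congʳ (inverse-* pₗ#0) ⟩
            1# + z * (inverse F pₗ#0 * g) ∎)

  module Congruence {s : Level} {A : Pred Carrier s} (A-ring : IsSubring A)
                    (m : Carrier) where

    open IsSubring A-ring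

    infix 4 _∼_
    -- The content is that the quotient e lies in `A`: in the field, anything is divisible by an m
    -- apart from zero. The next cluster variable will be read off as such a quotient.
    _∼_ : Carrier → Carrier → Set (c ⊔ a ⊔ s)
    x ∼ y = ∃[ e ] A e × x ≈ y + m * e

    ≈⇒∼ : ∀ {x y} → x ≈ y → x ∼ y
    ≈⇒∼ {x} {y} x≈y = 0# , 0∈ ,
      trans x≈y (solve 2 (λ y m → y := y :+ m :* con 0ℤ) refl y m)

    ∼-sym : ∀ {x y} → x ∼ y → y ∼ x
    ∼-sym {x} {y} (e , e∈ , h) = - e , -∈ e∈ , using-≈ (sym h)
      (solve 4 (λ x y m e → y :+ x := x :+ m :* :- e :+ (y :+ m :* e))
        refl x y m e)

    ∼-trans : ∀ {x y z} → x ∼ y → y ∼ z → x ∼ z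
    ∼-trans {x} {y} {z} (e , e∈ , h) (e′ , e′∈ , h′) = e′ + e , +∈ e′∈ e∈ ,
      trans h (trans (+-congʳ h′)
        (solve 4 (λ z m e′ e → z :+ m :* e′ :+ m :* e := z :+ m :* (e′ :+ e))
          refl z m e′ e))

    ∼-+ˡ : ∀ {x y} z → x ∼ y → z + x ∼ z + y
    ∼-+ˡ z (e , e∈ , h) = e , e∈ , trans (+-congˡ h) (sym (+-assoc z _ _))

    ∼-*ˡ : ∀ {x y z} → A z → x ∼ y → z * x ∼ z * y
    ∼-*ˡ {x} {y} {z} z∈ (e , e∈ , h) = z * e , *∈ z∈ e∈ ,
      trans (*-congˡ h)
        (solve 4 (λ z y m e → z :* (y :+ m :* e) := z :* y :+ m :* (z :* e))
          refl z y m e)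

    -- Modulo m, d is the inverse of b, so dˡ Σ qₖ bᵏ = Σ qₖ dˡ⁻ᵏ.
    module _ {b d : Carrier} (b∈ : A b) (d∈ : A d) (bd∼1 : b * d ∼ 1#) where

      ascending∼descending : ∀ {l} {q : Vector Carrier (suc l)} →
                             (∀ k → A (q k)) →
                             d ^ l * ascending q b ∼ descending q d
      ascending∼descending {zero} {q} q∈ = ≈⇒∼ (*-identityˡ _)
      ascending∼descending {suc l} {q} q∈ = ∼-trans (≈⇒∼ (begin
        d * d ^ l * ascending q b
          ≈⟨ *-congˡ (ascending-suc q b) ⟩
        d * d ^ l * (q zero + b * ascending (tail q) b)
          ≈⟨ solve 5 (λ d D q b t → d :* D :* (q :+ b :* t) :=
               q :* (d :* D) :+ D :* t :* (b :* d))
               refl d (d ^ l) (q zero) b (ascending (tail q) b) ⟩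
        q zero * d ^ suc l + d ^ l * ascending (tail q) b * (b * d) ∎))
        (∼-+ˡ _ (∼-trans (∼-*ˡ asc∈ bd∼1) (∼-trans (≈⇒∼ (*-identityʳ _))
          (ascending∼descending λ k → q∈ (suc k)))))
        where
        asc∈ : A (d ^ l * ascending (tail q) b)
        asc∈ = *∈ (^∈ d∈ l) (adjoin-least A-ring (λ x∈ → x∈) b∈
          (ascending∈ A-ring (λ k → q∈ (suc k)) b))

      descending∼ascending : ∀ {l} {q : Vector Carrier (suc l)} →
                             (∀ k → A (q k)) →
                             b ^ l * descending q d ∼ ascending q b
      descending∼ascending {zero} {q} q∈ = ≈⇒∼ (*-identityˡ _)
      descending∼ascending {suc l} {q} q∈ = ∼-trans (≈⇒∼ (begin
        b * b ^ l * (q zero * d ^ suc l + descending (tail q) d)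
          ≈⟨ solve 5 (λ b B q D t → b :* B :* (q :* D :+ t) :=
               b :* (B :* t) :+ q :* (b :* B :* D))
               refl b (b ^ l) (q zero) (d ^ suc l) (descending (tail q) d) ⟩
        b * (b ^ l * descending (tail q) d) + q zero * (b ^ suc l * d ^ suc l)
          ≈⟨ +-congˡ (*-congˡ (^-distrib-* b d (suc l))) ⟨
        b * (b ^ l * descending (tail q) d) + q zero * (b * d) ^ suc l ∎))
        (∼-trans (∼-+ˡ _ (∼-*ˡ (q∈ zero) (power∼1 (suc l))))
        (∼-trans (≈⇒∼ (trans (+-comm _ _) (+-congʳ (*-identityʳ _))))
        (∼-trans (∼-+ˡ _ (∼-*ˡ b∈ (descending∼ascending λ k → q∈ (suc k))))
        (≈⇒∼ (sym (ascending-suc q b))))))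
        where
        power∼1 : ∀ n → (b * d) ^ n ∼ 1#
        power∼1 zero    = ≈⇒∼ refl
        power∼1 (suc n) = ∼-trans (∼-*ˡ (*∈ b∈ d∈) (power∼1 n))
          (∼-trans (≈⇒∼ (*-identityʳ _)) bd∼1)

  open Congruence using
    (∼-sym; ∼-trans; ∼-*ˡ; ≈⇒∼; ascending∼descending; descending∼ascending)

  -- What the exchange step needs from g being the reversal of f, up to a unit. It is phrased
  -- through values, so that passing from `P` to `P̄` and back has one form.
  Reciprocal : ∀ {r} → Pred Carrier r → (Carrier → Carrier) →
               (Carrier → Carrier) → Set _
  Reciprocal {r} R f g =
    ∀ {A : Pred Carrier r} (A-ring : IsSubring A) → R ⊆ A →
    ∀ {m b d} → let open Congruence A-ring m in
    A b → A d → b * d ∼ 1# → f b ∼ 0# → g d ∼ 0#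

  module _ {r : Level} {R : Pred Carrier r} (R-ring : IsSubring R)
           {l : ℕ} {p : Vector Carrier l} (p∈ : ∀ k → R (p k))
           (pₗ#0 : leading F p # 0#) (pₗ⁻¹∈ : R (inverse F pₗ#0)) where

    P-reciprocal : Reciprocal R (P F p) (P̄ F p pₗ#0)
    P-reciprocal A-ring R⊆A {m} {b} {d} b∈ d∈ bd∼1 fb∼0 =
      trans′ (≈⇒∼ A-ring m (*-comm _ _))
      (trans′ (∼-*ˡ A-ring m (R⊆A pₗ⁻¹∈)
        (trans′ (∼-sym A-ring m (ascending∼descending A-ring m b∈ d∈ bd∼1
                   (λ k → R⊆A (coeff∈ R-ring p∈ k))))
        (trans′ (∼-*ˡ A-ring m (IsSubring.^∈ A-ring d∈ l) fb∼0)
        (≈⇒∼ A-ring m (zeroʳ _)))))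
      (≈⇒∼ A-ring m (zeroʳ _)))
      where trans′ = ∼-trans A-ring m

    -- Modulo m, P(d) = dˡ pₗ P̄(b); the factor pₗ undoes the normalisation of `P̄`.
    P̄-reciprocal : Reciprocal R (P̄ F p pₗ#0) (P F p)
    P̄-reciprocal A-ring R⊆A {m} {b} {d} b∈ d∈ bd∼1 fb∼0 =
      trans′ (∼-sym A-ring m (descending∼ascending A-ring m d∈ b∈
                (trans′ (≈⇒∼ A-ring m (*-comm d b)) bd∼1)
                (λ k → R⊆A (coeff∈ R-ring p∈ k))))
      (trans′ (≈⇒∼ A-ring m eq)
      (trans′ (∼-*ˡ A-ring m (IsSubring.*∈ A-ring (IsSubring.^∈ A-ring d∈ l)
                 (R⊆A (coeff∈ R-ring p∈ (fromℕ l)))) fb∼0)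
      (≈⇒∼ A-ring m (zeroʳ _))))
      where
      trans′ = ∼-trans A-ring m
      i D t : Carrier
      i = inverse F pₗ#0
      D = d ^ l
      t = descending (coeff F p) b
      eq : D * t ≈ D * leading F p * (t * i)
      eq = begin
        D * t                          ≈⟨ *-identityʳ _ ⟨
        D * t * 1#                     ≈⟨ *-congˡ (inverse-* pₗ#0) ⟨
        D * t * (leading F p * i)      ≈⟨ solve 4 (λ D t p i →
                                            D :* t :* (p :* i) :=
                                            D :* p :* (t :* i))
                                            refl D t (leading F p) i ⟩
        D * leading F p * (t * i)      ∎

-- Independence of the initial variables

module RationalFunctions {c a ℓ : Level} (F : HeytingField c a ℓ) where
  open HeytingField F hiding (zero)
  open Subrings F

  nonZeroPoly? : ∀ n f → Dec (NonZeroPoly n f)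
  nonZeroPoly? zero    f = ¬? (f ℚ.≟ 0ℚ)
  nonZeroPoly? (suc n) f = Any.any? (nonZeroPoly? n) f

  module _ {n : ℕ} {v : Vector Carrier n} (field′ : IsRationalFunctionField F v) where

    open IsRationalFunctionField field′
    open IsRingHomomorphism ι-isHomomorphism

    eval≈0 : ∀ n (v : Vector Carrier n) f → ¬ NonZeroPoly n f → eval F ι n v f ≈ 0#
    eval≈0 zero    v f       f≈0 = trans
      (reflexive (≡.cong ι (decidable-stable (f ℚ.≟ 0ℚ) f≈0))) 0#-homo
    eval≈0 (suc n) v []      f≈0 = refl
    eval≈0 (suc n) v (f ∷ g) f≈0 = trans
      (+-cong (eval≈0 n (tail v) f λ h → f≈0 (here h))
        (trans (*-congˡ (eval≈0 (suc n) v g λ h → f≈0 (there h))) (zeroʳ _)))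
      (+-identityʳ 0#)

    ≉0⇒#0 : ∀ {y} → ¬ (y ≈ 0#) → y # 0#
    ≉0⇒#0 {y} y≉0 with fractions y
    ... | f , g , g≢0 , y*g≈f with nonZeroPoly? n f
    ...   | no f≡0  = ⊥-elim (y≉0 (*≈0⇒≈0 (independent g g≢0)
                        (trans (*-comm _ y) (trans y*g≈f (eval≈0 n v f f≡0)))))
    ...   | yes f≢0 with reciprocal (independent f f≢0)
    ...     | z , fz≈1 = invertible⇒#0
                (trans (sym (*-assoc y _ z)) (trans (*-congʳ y*g≈f) fz≈1))

    -- A data type in order to reach the level `c ⊔ a` of the adjunctions, since `Values` must have
    -- one level in both clauses.
    data Constants : Pred Carrier (c ⊔ a) where
      constant : ∀ {y} q → ι q ≈ y → Constants y

    constants-isSubring : IsSubring Constants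
    constants-isSubring = record
      { ≈∈ = λ { x≈y (constant q e) → constant q (trans e x≈y) }
      ; 0∈   = constant 0ℚ 0#-homo
      ; 1∈   = constant ℚ.1ℚ 1#-homo
      ; -∈   = λ { (constant q e) → constant (ℚ.- q)
                     (trans (-‿homo q) (-‿cong e)) }
      ; +∈   = λ { (constant q e) (constant r h) → constant (q ℚ.+ r)
                     (trans (+-homo q r) (+-cong e h)) }
      ; *∈   = λ { (constant q e) (constant r h) → constant (q ℚ.* r)
                     (trans (*-homo q r) (*-cong e h)) }
      }

    Values : ∀ {n} → Vector Carrier n → Pred Carrier (c ⊔ a)
    Values {zero}  v = Constants
    Values {suc n} v = Values (tail v) [ head v ]

    values-isSubring : ∀ {n} (v : Vector Carrier n) → IsSubring (Values v)
    values-isSubring {zero}  v = constants-isSubring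
    values-isSubring {suc n} v = adjoin-isSubring (values-isSubring (tail v))

    variable∈values : ∀ {n} (v : Vector Carrier n) i → Values v (v i)
    variable∈values v zero    = adjoin-var (values-isSubring (tail v))
    variable∈values v (suc i) = adjoin-const (values-isSubring (tail v))
      (variable∈values (tail v) i)

    values⇒eval : ∀ {n} (v : Vector Carrier n) {y} → Values v y →
                  ∃[ f ] eval F ι n v f ≈ y
    values⇒eval {suc n} v (nil y≈0) = [] , sym y≈0
    values⇒eval {suc n} v (cons r∈ f∈ e)
      with values⇒eval (tail v) r∈ | values⇒eval v f∈
    ... | r , r≈ | f , f≈ = r ∷ f , trans (+-cong r≈ (*-congˡ f≈)) (sym e)
    values⇒eval {zero} v (constant q e) = q , e

    AlgebraicallyIndependent : ∀ {n} → Vector Carrier n → Set ℓ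
    AlgebraicallyIndependent {n} v =
      ∀ f → NonZeroPoly n f → eval F ι n v f # 0#

    independent-tail : ∀ {n} {v : Vector Carrier (suc n)} →
      AlgebraicallyIndependent v → AlgebraicallyIndependent (tail v)
    independent-tail {n} {v} ind f f≢0 = #-congʳ
      (trans (+-congˡ (zeroʳ _)) (+-identityʳ _)) (ind (f ∷ []) (here f≢0))

    -- The relation says that the polynomial `p ∷ q` has value zero. If `p` were nonzero, so would
    -- be `p ∷ q`, and its value would be apart from zero.
    independent⇒transcendental : ∀ {n} {v : Vector Carrier (suc n)} →
      AlgebraicallyIndependent v → Transcendental (Values (tail v)) (head v)
    independent⇒transcendental {n} {v} ind {r} {f} r∈ f∈ h
      with values⇒eval (tail v) r∈ | values⇒eval v f∈
    ... | p , p≈r | q , q≈f with nonZeroPoly? n p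
    ...   | no p≡0  = trans (sym p≈r) (eval≈0 n (tail v) p p≡0)
    ...   | yes p≢0 = ⊥-elim (#-irrefl
      (trans (+-cong p≈r (*-congˡ q≈f)) h) (ind (p ∷ q) (here p≢0)))

    -- With V the values of the remaining variables, v₀ is transcendental over Frac(V[v₁]), which
    -- contains Frac(V)[v₁].
    independent-variables : ∀ {n} {v : Vector Carrier (suc (suc n))} →
      AlgebraicallyIndependent v →
      Independent (Frac (Values (tail (tail v)))) (v (suc zero)) (v zero)
    independent-variables {v = v} ind =
      transcendental-frac V-ring (independent⇒transcendental (independent-tail ind)) ,
      transcendental-⊆ (adjoin-least (frac-isSubring V₁-ring)
          (λ (q , (q∈ , q#0) , qy∈) →
            q , (adjoin-const V-ring q∈ , q#0) , adjoin-const V-ring qy∈)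
          (frac-const V₁-ring (adjoin-var V-ring)))
        (transcendental-frac V₁-ring (independent⇒transcendental ind))
      where
      V-ring : IsSubring (Values (tail (tail v)))
      V-ring = values-isSubring (tail (tail v))
      V₁-ring : IsSubring (Values (tail v))
      V₁-ring = values-isSubring (tail v)

-- The cluster sequence

open import Data.Integer.Base using (_+_; _-_)

suc-%ℕ : ∀ k → (k + 1ℤ) %ℕ 4 ≡ suc (k %ℕ 4) ℕ.% 4
suc-%ℕ (+ n) = ≡.trans (≡.cong (ℕ._% 4) (ℕ.+-comm n 1)) (%-distribˡ-+ 1 n 4)
-- Five explicit cases for period four: adding 1 to `-[1+ 0 ]` leaves the negative integers, so the
-- recursion must land on some `-[1+ suc n ]`.
suc-%ℕ -[1+ 0 ] = ≡.refl
suc-%ℕ -[1+ 1 ] = ≡.refl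
suc-%ℕ -[1+ 2 ] = ≡.refl
suc-%ℕ -[1+ 3 ] = ≡.refl
suc-%ℕ -[1+ 4 ] = ≡.refl
suc-%ℕ -[1+ suc (suc (suc (suc (suc n)))) ] = suc-%ℕ -[1+ suc n ]

k+1-1≡k : ∀ k → k + 1ℤ - 1ℤ ≡ k
k+1-1≡k k = ≡.trans (ℤ.+-assoc k 1ℤ (ℤ.- 1ℤ)) (ℤ.+-identityʳ k)

k-1+1≡k : ∀ k → k - 1ℤ + 1ℤ ≡ k
k-1+1≡k k = ≡.trans (ℤ.+-assoc k (ℤ.- 1ℤ) 1ℤ) (ℤ.+-identityʳ k)

module _ {p : Level} {P : ℤ → Set p} (up : ∀ k → P k → P (k + 1ℤ))
         (down : ∀ k → P (k + 1ℤ) → P k) where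

  private
    from-0 : P 0ℤ → ∀ k → P k
    from-0 h (+ zero)     = h
    from-0 h (+ suc n)    = ≡.subst (λ m → P (+ m)) (ℕ.+-comm n 1)
      (up (+ n) (from-0 h (+ n)))
    from-0 h -[1+ zero ]  = down -[1+ zero ] h
    from-0 h -[1+ suc n ] = down -[1+ suc n ] (from-0 h -[1+ n ])

    to-0 : ∀ k → P k → P 0ℤ
    to-0 (+ zero)     h = h
    to-0 (+ suc n)    h = to-0 (+ n) (down (+ n)
      (≡.subst (λ m → P (+ m)) (ℕ.+-comm 1 n) h))
    to-0 -[1+ zero ]  h = up -[1+ zero ] h
    to-0 -[1+ suc n ] h = to-0 -[1+ n ] (up -[1+ suc n ] h)

  ℤ-induction : ∀ j k → P j → P k
  ℤ-induction j k h = from-0 (to-0 j h) k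

module Cluster {c a ℓ : Level} (F : HeytingField c a ℓ) {l₁ l₂ : ℕ}
  (p₁ : Vector (HeytingField.Carrier F) l₁)
  (p₂ : Vector (HeytingField.Carrier F) l₂)
  (x : ℤ → HeytingField.Carrier F)
  (isCluster : IsClusterSequence F p₁ p₂ x) where

  open HeytingField F hiding (zero; _+_; _-_)
  open Subrings F
  open Mutation F
  open UpperBound F
  open ExchangePolynomials F
  open RationalFunctions F
  open IsClusterSequence isCluster
  open IsRationalFunctionField ambient using (independent; variable#0)

  generated-isSubring : ∀ {s} {S : Pred Carrier s} → IsSubring (Subring⟨_⟩ F S)
  generated-isSubring = record
    { ≈∈ = resp ; 0∈ = zero ; 1∈ = one ; -∈ = neg ; +∈ = add ; *∈ = mul }

  generated-least : ∀ {s t} {S : Pred Carrier s} {T : Pred Carrier t} →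
                    IsSubring T → S ⊆ T → Subring⟨_⟩ F S ⊆ T
  generated-least {S = S} {T} T-ring S⊆T = go
    where
    open IsSubring T-ring
    go : Subring⟨_⟩ F S ⊆ T
    go (gen y∈)      = S⊆T y∈
    go zero          = 0∈
    go one           = 1∈
    go (neg y∈)      = -∈ (go y∈)
    go (add y∈ z∈)   = +∈ (go y∈) (go z∈)
    go (mul y∈ z∈)   = *∈ (go y∈) (go z∈)
    go (resp e y∈)   = ≈∈ e (go y∈)

  R : Pred Carrier (c ⊔ a)
  R = ℤ[ℙ] F p₁ p₂ x

  R-ring : IsSubring R
  R-ring = generated-isSubring

  -- Laurent monomials have denominators, so the independence of polynomial values reaches `R` only
  -- through the fractions.
  R⊆fractions : R ⊆ Frac (Values ambient (p₁ Vector.++ p₂))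
  R⊆fractions = generated-least (frac-isSubring V-ring) monomial
    where
    V-ring : IsSubring (Values ambient (p₁ Vector.++ p₂))
    V-ring = values-isSubring ambient (p₁ Vector.++ p₂)
    open IsSubring (frac-isSubring V-ring)
    variable∈ : ∀ i → Frac (Values ambient (p₁ Vector.++ p₂)) ((p₁ Vector.++ p₂) i)
    variable∈ i = frac-const V-ring (variable∈values ambient (p₁ Vector.++ p₂) i)
    monomial : ℙ F p₁ p₂ x ⊆ Frac (Values ambient (p₁ Vector.++ p₂))
    monomial (var₁ k)    = ≡.subst (Frac _) (lookup-++ˡ p₁ p₂ k) (variable∈ (k ↑ˡ l₂))
    monomial (var₂ k)    = ≡.subst (Frac _) (lookup-++ʳ p₁ p₂ k) (variable∈ (l₁ ↑ʳ k))
    monomial one         = 1∈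
    monomial (mul y∈ z∈) = *∈ (monomial y∈) (monomial z∈)
    monomial (inv e y∈)  = frac-inverse V-ring e (monomial y∈)
    monomial (resp e y∈) = ≈∈ e (monomial y∈)

  independent₂₁ : Independent R (x (+ 2)) (x 1ℤ)
  independent₂₁ =
    transcendental-⊆ R⊆fractions (proj₁ variables) ,
    transcendental-⊆ (adjoin-map R⊆fractions) (proj₂ variables)
    where variables = independent-variables ambient independent

  p₁∈ : ∀ k → R (p₁ k)
  p₁∈ k = gen (var₁ k)

  p₂∈ : ∀ k → R (p₂ k)
  p₂∈ k = gen (var₂ k)

  leading⁻¹∈ : ∀ {l} {p : Vector Carrier l} → (∀ k → ℙ F p₁ p₂ x (p k)) →
               (pₗ#0 : leading F p # 0#) → R (inverse F pₗ#0)
  leading⁻¹∈ {l} {p} p∈ pₗ#0 = gen (inv (inverse-* pₗ#0) (coeff∈ℙ (fromℕ l)))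
    where
    coeff∈ℙ : ∀ k → ℙ F p₁ p₂ x (coeff F p k)
    coeff∈ℙ zero    = one
    coeff∈ℙ (suc k) = p∈ k

  -- The exchange polynomial by residue modulo 4; the last clause stands for residue 0.
  Q : ℕ → Carrier → Carrier
  Q 1 = P F p₁
  Q 2 = P F p₂
  Q 3 = P̄₁ F p₁ p₂ x ambient
  Q _ = P̄₂ F p₁ p₂ x ambient

  private
    P₁#0 : leading F p₁ # 0#
    P₁#0 = leading#0 F p₁ (p₁#0 F p₁ p₂ x ambient)
    P₂#0 : leading F p₂ # 0#
    P₂#0 = leading#0 F p₂ (p₂#0 F p₁ p₂ x ambient)
    P₁⁻¹∈ : R (inverse F P₁#0)
    P₁⁻¹∈ = leading⁻¹∈ var₁ P₁#0
    P₂⁻¹∈ : R (inverse F P₂#0)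
    P₂⁻¹∈ = leading⁻¹∈ var₂ P₂#0

  Q-one+ : ∀ r z → One+ R z (Q r z)
  Q-one+ 0 = P̄-one+ R-ring p₂∈ P₂#0 P₂⁻¹∈
  Q-one+ 1 = P-one+ R-ring p₁∈
  Q-one+ 2 = P-one+ R-ring p₂∈
  Q-one+ 3 = P̄-one+ R-ring p₁∈ P₁#0 P₁⁻¹∈
  Q-one+ (suc (suc (suc (suc _)))) = P̄-one+ R-ring p₂∈ P₂#0 P₂⁻¹∈

  -- Indexed from the left neighbour, so that only iterated `+ 1ℤ` occurs in the window arguments.
  exchange : ∀ k → x (k + 1ℤ + 1ℤ) * x k ≈ Q ((k + 1ℤ) %ℕ 4) (x (k + 1ℤ))
  exchange k = ≡.subst
    (λ j → x (k + 1ℤ + 1ℤ) * x j ≈ Q ((k + 1ℤ) %ℕ 4) (x (k + 1ℤ)))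
    (k+1-1≡k k) (relation (k + 1ℤ) _ ≡.refl (n%ℕd<d (k + 1ℤ) 4))
    where
    relation : ∀ k r → k %ℕ 4 ≡ r → r ℕ.< 4 → x (k + 1ℤ) * x (k - 1ℤ) ≈ Q r (x k)
    relation k 0 e _ = exchange₀ k e
    relation k 1 e _ = exchange₁ k e
    relation k 2 e _ = exchange₂ k e
    relation k 3 e _ = exchange₃ k e
    relation k (suc (suc (suc (suc _)))) _ (s≤s (s≤s (s≤s (s≤s ()))))

  -- A shift by two exchanges Pᵢ with P̄ᵢ. Both directions are kept because a window is extended to
  -- the right and to the left.
  Q-reciprocal : ∀ k → Reciprocal R (Q (k %ℕ 4)) (Q ((k + 1ℤ + 1ℤ) %ℕ 4)) ×
                       Reciprocal R (Q ((k + 1ℤ + 1ℤ) %ℕ 4)) (Q (k %ℕ 4))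
  Q-reciprocal k = ≡.subst
    (λ r → Reciprocal R (Q (k %ℕ 4)) (Q r) × Reciprocal R (Q r) (Q (k %ℕ 4)))
    (≡.sym (≡.trans (suc-%ℕ (k + 1ℤ)) (≡.cong (λ r → suc r ℕ.% 4) (suc-%ℕ k))))
    (by-residue (k %ℕ 4) (n%ℕd<d k 4))
    where
    by-residue : ∀ r → r ℕ.< 4 → let r′ = suc (suc r ℕ.% 4) ℕ.% 4 in
                 Reciprocal R (Q r) (Q r′) × Reciprocal R (Q r′) (Q r)
    by-residue 0 _ = P̄-reciprocal R-ring p₂∈ P₂#0 P₂⁻¹∈ ,
                     P-reciprocal R-ring p₂∈ P₂#0 P₂⁻¹∈
    by-residue 1 _ = P-reciprocal R-ring p₁∈ P₁#0 P₁⁻¹∈ ,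
                     P̄-reciprocal R-ring p₁∈ P₁#0 P₁⁻¹∈
    by-residue 2 _ = P-reciprocal R-ring p₂∈ P₂#0 P₂⁻¹∈ ,
                     P̄-reciprocal R-ring p₂∈ P₂#0 P₂⁻¹∈
    by-residue 3 _ = P̄-reciprocal R-ring p₁∈ P₁#0 P₁⁻¹∈ ,
                     P-reciprocal R-ring p₁∈ P₁#0 P₁⁻¹∈
    by-residue (suc (suc (suc (suc _)))) (s≤s (s≤s (s≤s (s≤s ()))))

  -- Seeds: nonvanishing and independence of adjacent variables

  record Seed (k : ℤ) : Set (c ⊔ a ⊔ ℓ) where
    field
      xₖ#0         : x k # 0#
      xₖ₊₁#0       : x (k + 1ℤ) # 0#
      xₖ,xₖ₊₁-indep : Independent R (x k) (x (k + 1ℤ))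

  *#0⇒#0 : ∀ {y z} → y * z # 0# → z # 0#
  *#0⇒#0 {y} {z} yz#0 with reciprocal yz#0
  ... | w , yzw≈1 = invertible⇒#0 (trans
    (solve 3 (λ y z w → z :* (y :* w) := y :* z :* w) refl y z w) yzw≈1)

  -- If 1 + u g vanished, transcendence of u would give 1 = 0.
  one+#0 : ∀ {u q} → Transcendental R u → One+ R u q → q # 0#
  one+#0 tr (g , g∈ , e) = ≉0⇒#0 ambient λ q≈0 →
    #-irrefl (tr one g∈ (trans (sym e) q≈0)) 1#0

  seed-mutation : ∀ {q u v w} → One+ R u q → v * w ≈ q → v # 0# →
                  Independent R u v → Independent R u w × w # 0#
  seed-mutation q∈ vw≈q v#0 (tr-u , tr-v) =
    (tr-u , transcendental-mutation (adjoin-isSubring R-ring) tr-v v#0 vw≈q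
              (one+⊆ R-ring q∈)) ,
    *#0⇒#0 (#-congʳ (sym vw≈q) (one+#0 tr-u q∈))

  seed : ∀ k → Seed k
  seed k = ℤ-induction up down 1ℤ k record
    { xₖ#0 = variable#0 zero
    ; xₖ₊₁#0 = variable#0 (suc zero)
    ; xₖ,xₖ₊₁-indep = independent-swap R-ring (variable#0 zero) independent₂₁
    }
    where
    up : ∀ k → Seed k → Seed (k + 1ℤ)
    up k s = record
      { xₖ#0 = Seed.xₖ₊₁#0 s ; xₖ₊₁#0 = proj₂ mutated
      ; xₖ,xₖ₊₁-indep = proj₁ mutated }
      where
      mutated : Independent R (x (k + 1ℤ)) (x (k + 1ℤ + 1ℤ)) × x (k + 1ℤ + 1ℤ) # 0#
      mutated = seed-mutation (Q-one+ ((k + 1ℤ) %ℕ 4) (x (k + 1ℤ)))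
        (trans (*-comm _ _) (exchange k)) (Seed.xₖ#0 s)
        (independent-swap R-ring (Seed.xₖ₊₁#0 s) (Seed.xₖ,xₖ₊₁-indep s))
    down : ∀ k → Seed (k + 1ℤ) → Seed k
    down k s = record
      { xₖ#0 = proj₂ mutated ; xₖ₊₁#0 = Seed.xₖ#0 s
      ; xₖ,xₖ₊₁-indep = independent-swap R-ring (proj₂ mutated) (proj₁ mutated) }
      where
      mutated : Independent R (x (k + 1ℤ)) (x k) × x k # 0#
      mutated = seed-mutation (Q-one+ ((k + 1ℤ) %ℕ 4) (x (k + 1ℤ)))
        (exchange k) (Seed.xₖ₊₁#0 s) (Seed.xₖ,xₖ₊₁-indep s)

  x#0 : ∀ k → x k # 0#
  x#0 k = Seed.xₖ#0 (seed k)

  Q#0 : ∀ k r → Q r (x k) # 0#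
  Q#0 k r = one+#0 (proj₁ (Seed.xₖ,xₖ₊₁-indep (seed k))) (Q-one+ r (x k))

  -- The algebra of four consecutive variables

  Window : ℤ → Pred Carrier a
  Window n y = y ≈ x n ⊎ y ≈ x (n + 1ℤ) ⊎ y ≈ x (n + 1ℤ + 1ℤ) ⊎
               y ≈ x (n + 1ℤ + 1ℤ + 1ℤ)

  L : ℤ → Pred Carrier (c ⊔ a)
  L n = ℤ[ℙ][_] F p₁ p₂ x (Window n)

  R⊆L : ∀ n → R ⊆ L n
  R⊆L n r∈ = gen (inj₁ r∈)

  module _ (n : ℤ) where
    x₀∈ : L n (x n)
    x₀∈ = gen (inj₂ (inj₁ refl))
    x₁∈ : L n (x (n + 1ℤ))
    x₁∈ = gen (inj₂ (inj₂ (inj₁ refl)))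
    x₂∈ : L n (x (n + 1ℤ + 1ℤ))
    x₂∈ = gen (inj₂ (inj₂ (inj₂ (inj₁ refl))))
    x₃∈ : L n (x (n + 1ℤ + 1ℤ + 1ℤ))
    x₃∈ = gen (inj₂ (inj₂ (inj₂ (inj₂ refl))))

  L-least : ∀ {n t} {T : Pred Carrier t} → IsSubring T → R ⊆ T →
            T (x n) → T (x (n + 1ℤ)) → T (x (n + 1ℤ + 1ℤ)) →
            T (x (n + 1ℤ + 1ℤ + 1ℤ)) → L n ⊆ T
  L-least {n} {T = T} T-ring R⊆T h₀ h₁ h₂ h₃ = generated-least T-ring λ where
      (inj₁ r∈)                      → R⊆T r∈
      (inj₂ (inj₁ e))                → ≈∈ (sym e) h₀
      (inj₂ (inj₂ (inj₁ e)))         → ≈∈ (sym e) h₁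
      (inj₂ (inj₂ (inj₂ (inj₁ e))))  → ≈∈ (sym e) h₂
      (inj₂ (inj₂ (inj₂ (inj₂ e))))  → ≈∈ (sym e) h₃
    where open IsSubring T-ring

  module _ {A : Pred Carrier (c ⊔ a)} (A-ring : IsSubring A) (R⊆A : R ⊆ A)
           {f g : Carrier → Carrier} (recip : Reciprocal R f g)
           {b d v w q m : Carrier} (m∈ : A m) (m#0 : m # 0#)
           (b∈ : A b) (d∈ : A d) (v∈ : A v)
           (bd≈q : b * d ≈ q) (q∈ : One+ R m q)
           (vm≈fb : v * m ≈ f b) (wm≈gd : w * m ≈ g d) where

    private
      gd∼0 : Congruence._∼_ A-ring m (g d) 0#
      gd∼0 = recip A-ring R⊆A b∈ d∈
        (proj₁ q∈ , adjoin-least A-ring R⊆A m∈ (proj₁ (proj₂ q∈)) ,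
          trans bd≈q (proj₂ (proj₂ q∈)))
        (v , v∈ , trans (sym vm≈fb) (trans (*-comm v m) (sym (+-identityˡ _))))

    -- v, b, m, d, w are five consecutive variables read in either direction. Reciprocity gives g(d)
    -- = m e with e in `A`; as g(d) = w m, cancelling m identifies w with e.
    next-variable : A w
    next-variable = IsSubring.≈∈ A-ring (*-cancel-#0 m#0
      (trans (sym (+-identityˡ _)) (trans (sym (proj₂ (proj₂ gd∼0)))
        (trans (sym wm≈gd) (*-comm w m))))) (proj₁ (proj₂ gd∼0))

  x₄∈L : ∀ n → L n (x (n + 1ℤ + 1ℤ + 1ℤ + 1ℤ))
  x₄∈L n = next-variable generated-isSubring (R⊆L n)
    (proj₁ (Q-reciprocal (n + 1ℤ))) (x₂∈ n) (x#0 (n + 1ℤ + 1ℤ))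
    (x₁∈ n) (x₃∈ n) (x₀∈ n)
    (trans (*-comm _ _) (exchange (n + 1ℤ)))
    (Q-one+ ((n + 1ℤ + 1ℤ) %ℕ 4) (x (n + 1ℤ + 1ℤ)))
    (trans (*-comm _ _) (exchange n)) (exchange (n + 1ℤ + 1ℤ))

  x₋₁∈L : ∀ n → L (n + 1ℤ) (x n)
  x₋₁∈L n = next-variable generated-isSubring (R⊆L (n + 1ℤ))
    (proj₂ (Q-reciprocal (n + 1ℤ))) (x₁∈ (n + 1ℤ)) (x#0 (n + 1ℤ + 1ℤ))
    (x₂∈ (n + 1ℤ)) (x₀∈ (n + 1ℤ)) (x₃∈ (n + 1ℤ))
    (exchange (n + 1ℤ))
    (Q-one+ ((n + 1ℤ + 1ℤ) %ℕ 4) (x (n + 1ℤ + 1ℤ)))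
    (exchange (n + 1ℤ + 1ℤ)) (trans (*-comm _ _) (exchange n))

  L-suc : ∀ n → L n ⊆ L (n + 1ℤ)
  L-suc n = L-least generated-isSubring (R⊆L (n + 1ℤ)) (x₋₁∈L n)
    (x₀∈ (n + 1ℤ)) (x₁∈ (n + 1ℤ)) (x₂∈ (n + 1ℤ))

  L-pred : ∀ n → L (n + 1ℤ) ⊆ L n
  L-pred n = L-least generated-isSubring (R⊆L n) (x₁∈ n) (x₂∈ n) (x₃∈ n) (x₄∈L n)

  L-shift : ∀ j k → L j ⊆ L k
  L-shift j k {y} = ℤ-induction {P = λ n → L n y} (λ n → L-suc n) (λ n → L-pred n) j k

  𝒜⊆L : ∀ n → 𝒜 F p₁ p₂ x ⊆ L n
  𝒜⊆L n = generated-least generated-isSubring λ where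
    (inj₁ r∈)      → R⊆L n r∈
    (inj₂ (k , e)) → resp (sym e) (L-shift k n (x₀∈ k))

  L⊆𝒜 : ∀ n → L n ⊆ 𝒜 F p₁ p₂ x
  L⊆𝒜 n = L-least generated-isSubring (λ r∈ → gen (inj₁ r∈))
    (x∈ _) (x∈ _) (x∈ _) (x∈ _)
    where
    x∈ : ∀ k → 𝒜 F p₁ p₂ x (x k)
    x∈ k = gen (inj₂ (k , refl))

  -- Tori and iterated Laurent rings

  module _ (n : ℤ) where

    private
      T : Pred Carrier (c ⊔ a)
      T = 𝒯 F p₁ p₂ x n

      T-ring : IsSubring T
      T-ring = generated-isSubring

      R⊆T : R ⊆ T
      R⊆T r∈ = gen (inj₁ r∈)
      xₙ∈T : T (x n)
      xₙ∈T = gen (inj₂ (inj₁ (inj₁ refl)))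
      xₙ₊₁∈T : T (x (n + 1ℤ))
      xₙ₊₁∈T = gen (inj₂ (inj₂ (inj₁ refl)))

      quotient∈T : ∀ {u w q} → T u → (∀ {z} → u * z ≈ 1# → T z) → u # 0# →
                   w * u ≈ q → T q → T w
      quotient∈T {u} {w} u∈ u⁻¹∈ u#0 wu≈q q∈ = resp
        (trans (*-congʳ (sym wu≈q)) (trans (*-assoc w u _)
          (trans (*-congˡ uu⁻¹≈1) (*-identityʳ w))))
        (mul q∈ (u⁻¹∈ uu⁻¹≈1))
        where uu⁻¹≈1 = proj₂ (reciprocal u#0)

      xₙ₊₂∈T : T (x (n + 1ℤ + 1ℤ))
      xₙ₊₂∈T = quotient∈T xₙ∈T (λ e → gen (inj₂ (inj₁ (inj₂ e)))) (x#0 n)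
        (exchange n)
        (adjoin-least T-ring R⊆T xₙ₊₁∈T
          (one+⊆ R-ring (Q-one+ ((n + 1ℤ) %ℕ 4) _)))

      xₙ₊₃∈T : T (x (n + 1ℤ + 1ℤ + 1ℤ))
      xₙ₊₃∈T = quotient∈T xₙ₊₁∈T (λ e → gen (inj₂ (inj₂ (inj₂ e)))) (x#0 (n + 1ℤ))
        (exchange (n + 1ℤ))
        (adjoin-least T-ring R⊆T xₙ₊₂∈T
          (one+⊆ R-ring (Q-one+ ((n + 1ℤ + 1ℤ) %ℕ 4) _)))

    -- With the torus at the left end of the window, the other two variables cost one division each,
    -- by xₙ and by xₙ₊₁. The Laurent property of distant variables comes from shifting windows.
    L⊆𝒯 : L n ⊆ 𝒯 F p₁ p₂ x n
    L⊆𝒯 = L-least T-ring R⊆T xₙ∈T xₙ₊₁∈T xₙ₊₂∈T xₙ₊₃∈T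

    private
      laurent-ring : ∀ {v} → IsSubring (R [ v ±¹])
      laurent-ring = laurent-isSubring R-ring

      ±¹⊆inner : ∀ {v w} → _±¹ F v ⊆ (R [ v ±¹]) [ w ±¹]
      ±¹⊆inner (inj₁ e) = IsSubring.≈∈ (laurent-isSubring laurent-ring) (sym e)
        (laurent-const laurent-ring (laurent-var R-ring))
      ±¹⊆inner (inj₂ e) = laurent-const laurent-ring (laurent-inverse R-ring e)

      ±¹⊆outer : ∀ {v w} → _±¹ F w ⊆ (R [ v ±¹]) [ w ±¹]
      ±¹⊆outer (inj₁ e) = IsSubring.≈∈ (laurent-isSubring laurent-ring) (sym e)
        (laurent-var laurent-ring)
      ±¹⊆outer (inj₂ e) = laurent-inverse laurent-ring e

      R⊆ : ∀ {v w} → R ⊆ (R [ v ±¹]) [ w ±¹]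
      R⊆ r∈ = laurent-const laurent-ring (laurent-const R-ring r∈)

    -- The torus treats its two variables alike, but comparing coefficients singles out the outer
    -- one; hence both nestings.
    𝒯⊆ₙ,ₙ₊₁ : T ⊆ (R [ x n ±¹]) [ x (n + 1ℤ) ±¹]
    𝒯⊆ₙ,ₙ₊₁ = generated-least (laurent-isSubring laurent-ring)
      [ R⊆ , [ ±¹⊆inner , ±¹⊆outer ]′ ]′

    𝒯⊆ₙ₊₁,ₙ : T ⊆ (R [ x (n + 1ℤ) ±¹]) [ x n ±¹]
    𝒯⊆ₙ₊₁,ₙ = generated-least (laurent-isSubring laurent-ring)
      [ R⊆ , [ ±¹⊆outer , ±¹⊆inner ]′ ]′

  three-tori⊆L : ∀ n {y} → 𝒯 F p₁ p₂ x n y → 𝒯 F p₁ p₂ x (n + 1ℤ) y →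
                 𝒯 F p₁ p₂ x (n + 1ℤ + 1ℤ) y → L n y
  three-tori⊆L n y∈₀ y∈₁ y∈₂ = upper-bound R-ring generated-isSubring (R⊆L n)
    (x₀∈ n) (x₁∈ n) (x₂∈ n) (x₃∈ n) (x#0 _) (x#0 _) (x#0 _) (x#0 _)
    (exchange n) (Q-one+ r₁ (x (n + 1ℤ))) (Q#0 (n + 1ℤ) r₁)
    (trans (*-comm _ _) (exchange (n + 1ℤ))) (Q-one+ r₂ (x (n + 1ℤ + 1ℤ)))
    (Q#0 (n + 1ℤ + 1ℤ) r₂)
    (Seed.xₖ,xₖ₊₁-indep (seed (n + 1ℤ)))
    -- The third torus sits at the right end of the window, so the window is first moved by two.
    (λ y∈ → 𝒯⊆ₙ,ₙ₊₁ (n + 1ℤ + 1ℤ) (L⊆𝒯 (n + 1ℤ + 1ℤ) (L-shift n _ y∈)))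
    (𝒯⊆ₙ₊₁,ₙ n y∈₀) (𝒯⊆ₙ,ₙ₊₁ (n + 1ℤ) y∈₁) (𝒯⊆ₙ,ₙ₊₁ (n + 1ℤ + 1ℤ) y∈₂)
    where
    r₁ r₂ : ℕ
    r₁ = (n + 1ℤ) %ℕ 4
    r₂ = (n + 1ℤ + 1ℤ) %ℕ 4

  𝒜⊆𝒯 : ∀ k → 𝒜 F p₁ p₂ x ⊆ 𝒯 F p₁ p₂ x k
  𝒜⊆𝒯 k y∈ = L⊆𝒯 k (𝒜⊆L k y∈)

  three-tori⊆𝒜 : ∀ m {y} → 𝒯 F p₁ p₂ x (m - 1ℤ) y → 𝒯 F p₁ p₂ x m y →
                 𝒯 F p₁ p₂ x (m + 1ℤ) y → 𝒜 F p₁ p₂ x y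
  three-tori⊆𝒜 m {y} y∈₀ y∈₁ y∈₂ = L⊆𝒜 (m - 1ℤ) (three-tori⊆L (m - 1ℤ) y∈₀
    (≡.subst (λ k → 𝒯 F p₁ p₂ x k y) (≡.sym (k-1+1≡k m)) y∈₁)
    (≡.subst (λ k → 𝒯 F p₁ p₂ x (k + 1ℤ) y) (≡.sym (k-1+1≡k m)) y∈₂))

theoremA3 : ∀ {c a ℓ : Level} (F : HeytingField c a ℓ)
    (l₁ l₂ : ℕ) .{{_ : NonZero l₁}} .{{_ : NonZero l₂}}
    (p₁ : Vector (HeytingField.Carrier F) l₁) (p₂ : Vector (HeytingField.Carrier F) l₂) (x : ℤ → HeytingField.Carrier F) →
    IsClusterSequence F p₁ p₂ x →
    ∀ (m : ℤ) →
    (𝒜 F p₁ p₂ x ≐ ⋂ ℤ (𝒯 F p₁ p₂ x)) ×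
    (⋂ ℤ (𝒯 F p₁ p₂ x) ≐ (𝒯 F p₁ p₂ x (m - 1ℤ) ∩ 𝒯 F p₁ p₂ x m ∩ 𝒯 F p₁ p₂ x (m + 1ℤ)))
theoremA3 F l₁ l₂ p₁ p₂ x isCluster m =
  ((λ y∈ k → 𝒜⊆𝒯 k y∈) ,
   (λ y∈ → three-tori⊆𝒜 m (y∈ (m - 1ℤ)) (y∈ m) (y∈ (m + 1ℤ)))) ,
  ((λ y∈ → y∈ (m - 1ℤ) , y∈ m , y∈ (m + 1ℤ)) ,
   (λ (y∈₀ , y∈₁ , y∈₂) k → 𝒜⊆𝒯 k (three-tori⊆𝒜 m y∈₀ y∈₁ y∈₂)))
  where open Cluster F p₁ p₂ x isCluster
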